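{- For every integer $v \ge 4$ there are at least $\lfloor v^{1/6} \rfloor !$ pairwise non-isomorphic strongly regular graphs of order (number of vertices) at most $v$ satisfying the $4$-vertex condition.
   Context: Graphs are finite, simple and undirected. A graph of order $v$ is strongly regular with parameters $(v,k,\lambda,\mu)$ if it is neither complete nor edgeless, each vertex has degree $k$, any two adjacent vertices have exactly $\lambda$ common neighbors, and any two distinct non-adjacent vertices have exactly $\mu$ common neighbors. A graph $\Gamma$ satisfies the $t$-vertex condition if, for all triples $(T,x_0,y_0)$ consisting of a $t$-vertex graph $T$ together with two distinct distinguished vertices $x_0,y_0$ of $T$, and all pairs of distinct vertices $x,y$ of $\Gamma$, the number of isomorphic copies of $T$ in $\Gamma$ (as induced subgraphs), where the isomorphism maps $x_0$ to $x$ and $y_0$ to $y$, does not depend on the choice of the pair $x,y$ but only on whether $x,y$ are adjacent or nonadjacent. -}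

module Defs where

open import Data.Bool.Base using (Bool; true; false)
import Data.Bool.Properties as Bool
open import Data.Fin.Base using (Fin)
import Data.Fin.Properties as Fin
open import Data.Fin.Subset using (Subset; inside; outside; _∈_; _∩_; ∣_∣)
open import Data.Fin.Subset.Properties using (_∈?_)
open import Data.List.Base using (List; []; _∷_; _++_; map; filter; length)
open import Data.Nat.Base using (ℕ; zero; suc; _^_; _≤_; z≤n; s≤s)
open import Data.Nat.Properties using (_≤?_; ≤-trans; m≤n⇒m<n∨m≡n; ^-identityʳ; ^-monoʳ-≤)
open import Data.Product.Base using (Σ; ∃; _×_; _,_)
open import Data.Sum.Base using (inj₁; inj₂)
open import Data.Vec.Base using (Vec; []; _∷_; lookup; tabulate)
open import Function.Base using (_∘_)
open import Function.Bundles using (_↔_; Inverse)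
open import Relation.Binary.PropositionalEquality using (_≡_; _≢_; refl; subst)
open import Relation.Nullary.Decidable using (Dec; yes; no; map′; _×-dec_; _→-dec_)
open import Relation.Nullary.Negation using (¬_; contradiction)
open import Relation.Unary using (Pred; Decidable)

record Graph (n : ℕ) : Set where
  field
    adj    : Fin n → Fin n → Bool
    sym    : ∀ x y → adj x y ≡ adj y x
    irrefl : ∀ x → adj x x ≡ false

open Graph public using (adj)

infix 4 _≅_

_≅_ : ∀ {m n} → Graph m → Graph n → Set
_≅_ {m} {n} G H =
  Σ (Fin m ↔ Fin n) λ φ →
    ∀ x y → adj G x y ≡ adj H (Inverse.to φ x) (Inverse.to φ y)

Complete : ∀ {n} → Graph n → Set
Complete G = ∀ x y → x ≢ y → adj G x y ≡ true

Edgeless : ∀ {n} → Graph n → Set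
Edgeless G = ∀ x y → adj G x y ≡ false

neighbours : ∀ {n} → Graph n → Fin n → Subset n
neighbours G x = tabulate (adj G x)

commonNeighbours : ∀ {n} → Graph n → Fin n → Fin n → Subset n
commonNeighbours G x y = neighbours G x ∩ neighbours G y

record IsStronglyRegular {v} (G : Graph v) (k l m : ℕ) : Set where
  field
    notComplete : ¬ Complete G
    notEdgeless : ¬ Edgeless G
    regular     : ∀ x → ∣ neighbours G x ∣ ≡ k
    adjacent    : ∀ x y → adj G x y ≡ true → ∣ commonNeighbours G x y ∣ ≡ l
    nonadjacent : ∀ x y → x ≢ y → adj G x y ≡ false →
                  ∣ commonNeighbours G x y ∣ ≡ m

StronglyRegular : ∀ {v} → Graph v → Set
StronglyRegular G = ∃ λ k → ∃ λ l → ∃ λ m → IsStronglyRegular G k l m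

-- φ is an isomorphism from T onto the subgraph of G induced on S, taking x₀
-- to x and y₀ to y.  The map φ : Fin t → Fin n is stored as the vector of its
-- values, so that it can be searched for without function extensionality.

IsCopyVia : ∀ {t n} → Graph t → Fin t → Fin t → Graph n → Fin n → Fin n →
            Subset n → Vec (Fin n) t → Set
IsCopyVia T x₀ y₀ G x y S φ =
    (∀ i → lookup φ i ∈ S)
  × (∀ u → u ∈ S → ∃ λ i → lookup φ i ≡ u)
  × (∀ i j → lookup φ i ≡ lookup φ j → i ≡ j)
  × (∀ i j → adj T i j ≡ adj G (lookup φ i) (lookup φ j))
  × lookup φ x₀ ≡ x
  × lookup φ y₀ ≡ y

IsCopy : ∀ {t n} → Graph t → Fin t → Fin t → Graph n → Fin n → Fin n →
         Subset n → Set
IsCopy T x₀ y₀ G x y S = ∃ (IsCopyVia T x₀ y₀ G x y S)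

anyVec? : ∀ {n p} t {P : Pred (Vec (Fin n) t) p} → Decidable P → Dec (∃ P)
anyVec? zero    P? = map′ ([] ,_) (λ { ([] , p) → p }) (P? [])
anyVec? (suc t) P? =
  map′ (λ { (i , is , p) → (i ∷ is) , p })
       (λ { ((i ∷ is) , p) → i , is , p })
       (Fin.any? λ i → anyVec? t (P? ∘ (i ∷_)))

isCopy? : ∀ {t n} (T : Graph t) x₀ y₀ (G : Graph n) x y →
          Decidable (IsCopy T x₀ y₀ G x y)
isCopy? {t} T x₀ y₀ G x y S = anyVec? t λ φ →
        Fin.all? (λ i → lookup φ i ∈? S)
  ×-dec Fin.all? (λ u → (u ∈? S) →-dec Fin.any? (λ i → lookup φ i Fin.≟ u))
  ×-dec Fin.all? (λ i → Fin.all? λ j →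
          (lookup φ i Fin.≟ lookup φ j) →-dec (i Fin.≟ j))
  ×-dec Fin.all? (λ i → Fin.all? λ j →
          adj T i j Bool.≟ adj G (lookup φ i) (lookup φ j))
  ×-dec (lookup φ x₀ Fin.≟ x)
  ×-dec (lookup φ y₀ Fin.≟ y)

subsets : ∀ n → List (Subset n)
subsets zero    = [] ∷ []
subsets (suc n) = map (inside ∷_) (subsets n) ++ map (outside ∷_) (subsets n)

-- Copies are induced subgraphs, hence counted as vertex sets: different
-- isomorphisms from T onto the same subgraph are not counted separately.

copies : ∀ {t n} → Graph t → Fin t → Fin t → Graph n → Fin n → Fin n → ℕ
copies {n = n} T x₀ y₀ G x y = length (filter (isCopy? T x₀ y₀ G x y) (subsets n))

VertexCondition : ℕ → ∀ {n} → Graph n → Set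
VertexCondition t G =
  ∀ (T : Graph t) x₀ y₀ → x₀ ≢ y₀ →
  ∀ x y x′ y′ → x ≢ y → x′ ≢ y′ → adj G x y ≡ adj G x′ y′ →
  copies T x₀ y₀ G x y ≡ copies T x₀ y₀ G x′ y′

-- The largest r ≤ b with r ^ 6 ≤ v.

sixthRootUpTo : ℕ → ℕ → ℕ
sixthRootUpTo v zero    = zero
sixthRootUpTo v (suc b) with suc b ^ 6 ≤? v
... | yes _ = suc b
... | no  _ = sixthRootUpTo v b

⌊⁶√_⌋ : ℕ → ℕ
⌊⁶√ v ⌋ = sixthRootUpTo v v

sixthRootUpTo-^≤ : ∀ v b → sixthRootUpTo v b ^ 6 ≤ v
sixthRootUpTo-^≤ v zero    = z≤n
sixthRootUpTo-^≤ v (suc b) with suc b ^ 6 ≤? v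
... | yes p = p
... | no  _ = sixthRootUpTo-^≤ v b

sixthRootUpTo-max : ∀ v b r → r ≤ b → r ^ 6 ≤ v → r ≤ sixthRootUpTo v b
sixthRootUpTo-max v zero    r r≤b r^6≤v = r≤b
sixthRootUpTo-max v (suc b) r r≤b r^6≤v with suc b ^ 6 ≤? v
... | yes _ = r≤b
... | no ¬p with m≤n⇒m<n∨m≡n r≤b
...   | inj₁ (s≤s r≤b′) = sixthRootUpTo-max v b r r≤b′ r^6≤v
...   | inj₂ refl       = contradiction r^6≤v ¬p

n≤n^6 : ∀ n → n ≤ n ^ 6
n≤n^6 zero    = z≤n
n≤n^6 (suc n) = subst (_≤ suc n ^ 6) (^-identityʳ (suc n)) (^-monoʳ-≤ (suc n) {1} {6} (s≤s z≤n))

⌊⁶√⌋-^≤ : ∀ v → ⌊⁶√ v ⌋ ^ 6 ≤ v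
⌊⁶√⌋-^≤ v = sixthRootUpTo-^≤ v v

⌊⁶√⌋-max : ∀ v r → r ^ 6 ≤ v → r ≤ ⌊⁶√ v ⌋
⌊⁶√⌋-max v r r^6≤v = sixthRootUpTo-max v v r (≤-trans (n≤n^6 r) r^6≤v) r^6≤v

{-# OPTIONS --safe #-}

module Submission where

-- Let n = 2ᵈ.  A permutation σ of 𝔽₂ᵈ fixing 0 twists the symplectic form on
-- 𝔽₂ᵈ × 𝔽₂ᵈ on the pairs that meet the Lagrangian b = 0.  The signs S of the
-- twisted form still make up a symmetric Hadamard matrix of order n², and
-- Σ_{z,w} S(x,z) S(y,z) S(x,w) S(y,w) S(z,w) = n² for all x and y.  Hence the
-- graph on the n² − 1 nonzero points whose edges are the pairs with S = 1 is
-- strongly regular.  Its 4-vertex condition follows because every weighted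
-- count of the pairs (z , w) is multilinear in the five relations involved, so
-- that it is enough to weigh them by the identity, the all-one matrix and S;
-- then all sums except the one above collapse.
--
-- If σ fixes the standard basis, an isomorphism between two such graphs is
-- determined by the images of 2d base points, so that an isomorphism class
-- has at most (n²)²ᵈ members.  Triangular permutations alone give about
-- 2^(n − d²/2) graphs, enough for ⌊v^(1/6)⌋ ≥ 8 with d = 3⌊log₂ v^(1/6)⌋; below
-- that, perfect matchings of different orders suffice.

-- Matchings supply one graph per even order, and `2 r! + 2` exceeds `r ^ 6` from `r = 9` on, so
-- many graphs of one order are wanted. The twist is harmless because, for fixed second coordinates,
-- the form is still additive in the first ones. Summing over first coordinates therefore leaves
-- equations between second coordinates; `σ` enters these only where a second coordinate is 0, and
-- there injectivity and `σ 0 = 0` do what linearity would do. The row of 0 in S is constantly 1.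
-- Deleting this point leaves every row with sum -1, hence a regular graph. No automorphism group is
-- computed. Isomorphisms from two members of the family into a common third one are compared: the
-- relations to the base points do not see `σ`, so agreement on the base points makes the two maps
-- equal, and then the two sources are equal. The sixth root comes from the order: with `l` the
-- binary logarithm of `r` rounded down and `d = 3 l`, it is below `2 ^ (2 d) = 2 ^ (6 l)`, at most
-- `r ^ 6`. The family has about `8 ^ l` free bits, against about `(l + 1) 2 ^ (l + 1)` for `r !`
-- and `(2 d)²` for an isomorphism class.

open import Defs
open import Algebra.Structures using (IsCommutativeRing)
import Algebra.Properties.AbelianGroup as AbelianGroup
open import Data.Bool.Base using (Bool; true; false; if_then_else_; not; _∧_; _xor_)
import Data.Bool.Properties as Bool
open import Data.Fin.Base as Fin using (Fin; zero; suc; splitAt; join; toℕ; funToFin; finToFun)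
open import Data.Fin.Patterns
open import Data.Fin.Permutation using (↔⇒≡)
import Data.Fin.Properties as Fin
open import Data.Fin.Subset as Subset using (Subset; ∣_∣; ⁅_⁆; _∪_; _∩_; ⊤; ⊥)
import Data.Fin.Subset.Properties as Subset
open import Data.Integer.Base as ℤ using (ℤ; 0ℤ; 1ℤ; -1ℤ)
import Data.Integer.Properties as ℤ
import Data.Integer.Tactic.RingSolver as ℤSolver
open import Data.List.Base as List using (List; []; _∷_; _++_; map; filter; length; lookup; allFin; cartesianProduct)
import Data.List.Properties as List
open import Data.List.Membership.Propositional using (_∈_)
open import Data.List.Membership.Propositional.Properties
open import Data.List.Relation.Unary.All as All using (All; []; _∷_)
open import Data.List.Relation.Unary.Any using (here; there; index)
import Data.List.Relation.Unary.Any.Properties as Any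
open import Data.List.Relation.Unary.Unique.Propositional using (Unique; []; _∷_)
import Data.List.Relation.Unary.Unique.Propositional.Properties as Unique
open import Data.Nat.Base as ℕ using (ℕ; zero; suc; pred; _≤_; _<_; z≤n; s≤s; _^_; _!; NonZero)
import Data.Nat.Properties as ℕ
open import Data.Product.Base using (Σ; ∃; _×_; _,_; proj₁; proj₂)
import Data.Product.Properties as Product
open import Data.Sum.Base as Sum using (_⊎_; inj₁; inj₂)
import Data.Sum.Properties as Sum
open import Data.Vec.Base as Vec using (Vec; []; _∷_; zipWith; replicate; take; drop)
import Data.Vec.Properties as Vec
open import Function.Base using (_∘_)
open import Function.Bundles using (Inverse; mk⇔)
open import Function.Properties.Inverse using (↔-sym)
open import Relation.Binary.Definitions using (DecidableEquality; tri<; tri≈; tri>)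
open import Relation.Binary.PropositionalEquality using (_≡_; _≢_; refl; sym; trans; cong; cong₂; subst; subst₂; ≢-sym; module ≡-Reasoning)
open import Relation.Nullary.Decidable using (Dec; yes; no; does; ¬?; dec-true; dec-false; does-⇔; toWitness; _×-dec_; _⊎-dec_; _→-dec_)
open import Relation.Nullary.Negation using (¬_; contradiction)
open import Relation.Unary using (Decidable)

-- Arithmetic

module Arithmetic where
  open import Data.Nat.Base
  open import Data.Nat.Properties
  open import Data.Nat.Tactic.RingSolver using (solve-∀)
  open ≤-Reasoning

  -- The number of vectors in 𝔽₂ʲ of weight at least w.
  freedom : ℕ → ℕ → ℕ
  freedom zero    zero    = 1
  freedom zero    (suc w) = 0
  freedom (suc j) w       = freedom j (pred w) + freedom j w

  -- In a triangular permutation, a coordinate followed by `d` others is altered by a Boolean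
  -- function of those others that vanishes at weights 0 and 1. Such a function has `freedom d 2`
  -- free values, and they add up over the coordinates.
  bits : ℕ → ℕ
  bits zero    = 0
  bits (suc d) = freedom d 2 + bits d

  freedom₀ : ∀ j → freedom j 0 ≡ 2 ^ j
  freedom₀ zero    = refl
  freedom₀ (suc j) rewrite freedom₀ j = cong (2 ^ j +_) (sym (+-identityʳ _))

  freedom₁ : ∀ j → freedom j 1 + 1 ≡ 2 ^ j
  freedom₁ zero    = refl
  freedom₁ (suc j) rewrite freedom₀ j =
    trans (+-assoc (2 ^ j) _ 1) (cong (2 ^ j +_) (trans (freedom₁ j) (sym (+-identityʳ _))))

  freedom₂ : ∀ j → freedom j 2 + (j + 1) ≡ 2 ^ j
  freedom₂ zero    = refl
  freedom₂ (suc j) = trans (regroup (freedom j 1) (freedom j 2) j)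
    (cong₂ _+_ (freedom₁ j) (trans (freedom₂ j) (sym (+-identityʳ _))))
    where
    regroup : ∀ a b j → a + b + (suc j + 1) ≡ a + 1 + (b + (j + 1))
    regroup = solve-∀

  -- The exact value is `2 ^ d = bits d + d (d + 1) / 2 + 1`; bounding the triangular number by
  -- `d * d` avoids the division.
  bits-bound : ∀ d → 2 ^ d ≤ bits d + (d * d + 1)
  bits-bound zero    = s≤s z≤n
  bits-bound (suc d) = begin
    2 ^ d + (2 ^ d + 0)                                  ≡⟨ cong₂ _+_ (sym (freedom₂ d)) (+-identityʳ _) ⟩
    freedom d 2 + (d + 1) + 2 ^ d                        ≤⟨ +-monoʳ-≤ (freedom d 2 + (d + 1)) (bits-bound d) ⟩
    freedom d 2 + (d + 1) + (bits d + (d * d + 1))       ≤⟨ m≤m+n _ d ⟩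
    freedom d 2 + (d + 1) + (bits d + (d * d + 1)) + d   ≡⟨ regroup (freedom d 2) (bits d) d ⟩
    freedom d 2 + bits d + (suc d * suc d + 1)           ∎
    where
    regroup : ∀ a b d → a + (d + 1) + (b + (d * d + 1)) + d ≡ a + b + (suc d * suc d + 1)
    regroup = solve-∀

  !≤^ : ∀ {m b} → m ≤ b → m ! ≤ b ^ m
  !≤^ {zero}  _   = ≤-refl
  !≤^ {suc m} m<b = *-mono-≤ m<b (!≤^ (<⇒≤ m<b))

  -- With `l = 3 + m` and `d = 3 l`, the number 45 collects `(2 d)² + d² = 45 l²`: one square from
  -- the base points, one from `bits-bound`. At `l = 3` the inequality reads 470 against 512, while
  -- at `l = 2` it would be 205 against 64. This fixes the threshold `r = 8` between the two
  -- families.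
  cubic-bound : ∀ m → (4 + m) * (2 * 2 ^ (3 + m)) + (45 * ((3 + m) * (3 + m)) + 1) ≤ 2 ^ (3 + m) * (2 ^ (3 + m) * 2 ^ (3 + m))
  cubic-bound zero    = toWitness {a? = 470 ≤? 512} _
  cubic-bound (suc m) = begin
    (4 + suc m) * (2 * (2 * p)) + (45 * ((3 + suc m) * (3 + suc m)) + 1)
      -- The right side grows by the factor 8. The polynomial added here is exactly what the left
      -- side lacks for growing by 8 as well, and its coefficients are nonnegative.
      ≤⟨ m≤m+n _ _ ⟩
    (4 + suc m) * (2 * (2 * p)) + (45 * ((3 + suc m) * (3 + suc m)) + 1) +
        ((44 + 12 * m) * p + (315 * (m * m) + 1800 * m + 2527))
      ≡⟨ regroup m p ⟩
    8 * ((4 + m) * (2 * p) + (45 * ((3 + m) * (3 + m)) + 1))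
      ≤⟨ *-monoʳ-≤ 8 (cubic-bound m) ⟩
    8 * (p * (p * p))
      ≡⟨ octuple p ⟩
    2 * p * (2 * p * (2 * p)) ∎
    where
    p = 2 ^ (3 + m)
    regroup : ∀ m p → (4 + suc m) * (2 * (2 * p)) + (45 * ((3 + suc m) * (3 + suc m)) + 1) +
        ((44 + 12 * m) * p + (315 * (m * m) + 1800 * m + 2527))
              ≡ 8 * ((4 + m) * (2 * p) + (45 * ((3 + m) * (3 + m)) + 1))
    regroup = solve-∀
    octuple : ∀ p → 8 * (p * (p * p)) ≡ 2 * p * (2 * p * (2 * p))
    octuple = solve-∀

  cube : ∀ l → 2 ^ (l * 3) ≡ 2 ^ l * (2 ^ l * 2 ^ l)
  cube l = trans (sym (^-*-assoc 2 l 3)) (cong (λ x → 2 ^ l * (2 ^ l * x)) (*-identityʳ _))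

  enough-bits : ∀ m → let l = 3 + m; d = l * 3 in suc l * 2 ^ suc l + (d + d) * (d + d) ≤ bits d
  enough-bits m = +-cancelʳ-≤ (d * d + 1) _ _ (begin
    suc l * 2 ^ suc l + (d + d) * (d + d) + (d * d + 1) ≡⟨ regroup l (2 ^ l) ⟩
    suc l * (2 * 2 ^ l) + (45 * (l * l) + 1)            ≤⟨ cubic-bound m ⟩
    2 ^ l * (2 ^ l * 2 ^ l)                             ≡⟨ cube l ⟨
    2 ^ d                                               ≤⟨ bits-bound d ⟩
    bits d + (d * d + 1)                                ∎)
    where
    l = 3 + m
    d = l * 3
    regroup : ∀ l p → suc l * (2 * p) + (l * 3 + l * 3) * (l * 3 + l * 3) + (l * 3 * (l * 3) + 1) ≡ suc l * (2 * p) +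
        (45 * (l * l) + 1)
    regroup = solve-∀

  -- There are 2 ^ bits d triangular permutations, and at most n ^ (d + d) of
  -- them give isomorphic graphs, where n is the order.
  family-size : ∀ m {r n} → let l = 3 + m; d = l * 3 in r ≤ 2 ^ suc l → n ≤ 2 ^ d * 2 ^ d → r ! * n ^ (d + d) ≤ 2 ^ bits d
  family-size m {r} {n} r≤ n≤ = begin
    r ! * n ^ (d + d)                              ≤⟨ *-mono-≤ r!≤ n^≤ ⟩
    2 ^ (suc l * 2 ^ suc l) * 2 ^ ((d + d) * (d + d)) ≡⟨ ^-distribˡ-+-* 2 (suc l * 2 ^ suc l) ((d + d) * (d + d)) ⟨
    2 ^ (suc l * 2 ^ suc l + (d + d) * (d + d))    ≤⟨ ^-monoʳ-≤ 2 (enough-bits m) ⟩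
    2 ^ bits d                                     ∎
    where
    l = 3 + m
    d = l * 3
    r!≤ : r ! ≤ 2 ^ (suc l * 2 ^ suc l)
    r!≤ = begin
      r !                         ≤⟨ !≤^ r≤ ⟩
      (2 ^ suc l) ^ r             ≤⟨ ^-monoʳ-≤ (2 ^ suc l) {{m^n≢0 2 (suc l)}} r≤ ⟩
      (2 ^ suc l) ^ (2 ^ suc l)   ≡⟨ ^-*-assoc 2 (suc l) (2 ^ suc l) ⟩
      2 ^ (suc l * 2 ^ suc l)     ∎
    n^≤ : n ^ (d + d) ≤ 2 ^ ((d + d) * (d + d))
    n^≤ = begin
      n ^ (d + d)                 ≤⟨ ^-monoˡ-≤ (d + d) n≤ ⟩
      (2 ^ d * 2 ^ d) ^ (d + d)   ≡⟨ cong (_^ (d + d)) (^-distribˡ-+-* 2 d d) ⟨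
      (2 ^ (d + d)) ^ (d + d)     ≡⟨ ^-*-assoc 2 (d + d) (d + d) ⟩
      2 ^ ((d + d) * (d + d))     ∎

  log₂ : ∀ r → 1 ≤ r → ∃ λ l → 2 ^ l ≤ r × r < 2 ^ suc l
  log₂ (suc zero)    _ = 0 , s≤s z≤n , s≤s (s≤s z≤n)
  log₂ (suc (suc r)) _ with log₂ (suc r) (s≤s z≤n)
  ... | l , lo , hi with m≤n⇒m<n∨m≡n hi
  ...   | inj₁ lt = l , m≤n⇒m≤1+n lo , lt
  ...   | inj₂ eq = suc l , ≤-reflexive (sym eq) , grow eq
    where
    grow : ∀ {x y} → suc x ≡ y → suc x < 2 * y
    grow {x} refl = m<m+n (suc x) (s≤s z≤n)

  exponent-≥3 : ∀ l → 8 < 2 ^ suc l → ∃ λ m → l ≡ 3 + m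
  exponent-≥3 0 8<2 = contradiction 8<2 (toWitness {a? = ¬? (8 <? 2)} _)
  exponent-≥3 1 8<4 = contradiction 8<4 (toWitness {a? = ¬? (8 <? 4)} _)
  exponent-≥3 2 8<8 = contradiction 8<8 (toWitness {a? = ¬? (8 <? 8)} _)
  exponent-≥3 (suc (suc (suc m))) _ = m , refl

  n*2≡n+n : ∀ n → n * 2 ≡ n + n
  n*2≡n+n = solve-∀

  1+n+1+n≡n+n+2 : ∀ n → suc n + suc n ≡ n + n + 2
  1+n+1+n≡n+n+2 = solve-∀

  power₆ : ∀ {x r} → x ≤ r → x * (x * x) * (x * (x * x)) ≤ r ^ 6
  power₆ {x} {r} x≤r = begin
    x * (x * x) * (x * (x * x)) ≡⟨ expand x ⟩
    x ^ 6                       ≤⟨ ^-monoˡ-≤ 6 x≤r ⟩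
    r ^ 6                       ∎
    where
    expand : ∀ x → x * (x * x) * (x * (x * x)) ≡ x * (x * (x * (x * (x * (x * 1)))))
    expand = solve-∀

  -- The matchings used have from 2 to `r ! + 1` edges, so the largest has `r ! + r ! + 2` vertices.
  -- For `r` equal to 0 or 1 this is 4, exactly what is assumed of `v`; the other cases follow from
  -- `r ^ 6 ≤ v`.
  small-family : ∀ r v → r ≤ 7 → 4 ≤ v → r ^ 6 ≤ v → r ! + r ! + 2 ≤ v
  small-family 0 v _ 4≤v _ = 4≤v
  small-family 1 v _ 4≤v _ = 4≤v
  small-family 2 v _ _ le = ≤-trans (toWitness {a? = 6 ≤? 64} _) le
  small-family 3 v _ _ le = ≤-trans (toWitness {a? = 14 ≤? 729} _) le
  small-family 4 v _ _ le = ≤-trans (toWitness {a? = 50 ≤? 4096} _) le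
  small-family 5 v _ _ le = ≤-trans (toWitness {a? = 242 ≤? 15625} _) le
  small-family 6 v _ _ le = ≤-trans (toWitness {a? = 1442 ≤? 46656} _) le
  small-family 7 v _ _ le = ≤-trans (toWitness {a? = 10082 ≤? 117649} _) le
  small-family (suc (suc (suc (suc (suc (suc (suc (suc _)))))))) v (s≤s (s≤s (s≤s (s≤s (s≤s (s≤s (s≤s ()))))))) _ _

open Arithmetic using (freedom; bits; cube; power₆; family-size; log₂; exponent-≥3; small-family; n*2≡n+n; 1+n+1+n≡n+n+2)

-- Finite sums

infixl 6 _+_
infixl 7 _*_

-- The operations of ℤ, made opaque so that unification treats them as injective.
opaque
  _+_ : ℤ → ℤ → ℤ
  _+_ = ℤ._+_

  _*_ : ℤ → ℤ → ℤ
  _*_ = ℤ._*_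

  isCommutativeRing : IsCommutativeRing _≡_ _+_ _*_ ℤ.-_ 0ℤ 1ℤ
  isCommutativeRing = ℤ.+-*-isCommutativeRing

  +-interchange : ∀ a b c d → a + b + (c + d) ≡ a + c + (b + d)
  +-interchange = ℤSolver.solve-∀

  *-interchange : ∀ a b c d → a * b * (c * d) ≡ a * c * (b * d)
  *-interchange = ℤSolver.solve-∀

  suc-* : ∀ n c → c + ℤ.+ n * c ≡ ℤ.+ suc n * c
  suc-* n c = sym (ℤ.suc-* (ℤ.+ n) c)

  pos-+ : ∀ m n → ℤ.+ (m ℕ.+ n) ≡ ℤ.+ m + ℤ.+ n
  pos-+ = ℤ.pos-+

  -1*a+a : ∀ a → -1ℤ * a + a ≡ 0ℤ
  -1*a+a = ℤSolver.solve-∀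

  -1*-1 : -1ℤ * -1ℤ ≡ 1ℤ
  -1*-1 = refl

  +-cancelˡ : ∀ a b c → a + b ≡ a + c → b ≡ c
  +-cancelˡ = AbelianGroup.∙-cancelˡ ℤ.+-0-abelianGroup

  *-collect₁₀ : ∀ a₁ e₁ a₂ e₂ a₃ g₁ a₄ g₂ e₃ g₃ →
    (a₁ * e₁) * (a₂ * e₂) * ((a₃ * g₁) * (a₄ * g₂)) * (e₃ * g₃) ≡
    (a₁ * a₂) * (a₃ * a₄) * ((e₁ * e₂ * e₃) * (g₁ * g₂ * g₃))
  *-collect₁₀ = ℤSolver.solve-∀

  *-pull : ∀ n x y k → k * ((n * x) * (n * y)) ≡ x * (y * (n * n * k))
  *-pull = ℤSolver.solve-∀

  *-solve₂ : ∀ s t c e c′ e′ → s ≢ t → c + e ≡ c′ + e′ → s * c + t * e ≡ s * c′ + t * e′ → c ≡ c′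
  *-solve₂ s t c e c′ e′ s≢t eq₁ eq₂ =
    ℤ.*-cancelˡ-≡ (s ℤ.- t) c c′ {{ℤ.≢-nonZero (λ eq → s≢t (ℤ.i-j≡0⇒i≡j s t eq))}}
      (trans (eliminate s t c e) (trans (cong₂ (λ a b → a ℤ.- t * b) eq₂ eq₁) (sym (eliminate s t c′ e′))))
    where
    eliminate : ∀ s t c e → (s ℤ.- t) * c ≡ (s * c + t * e) ℤ.- t * (c + e)
    eliminate = ℤSolver.solve-∀

  double-injective : ∀ m n → ℤ.+ m * (1ℤ + 1ℤ) ≡ ℤ.+ n * (1ℤ + 1ℤ) → m ≡ n
  double-injective m n eq = ℤ.+-injective (ℤ.*-cancelʳ-≡ (ℤ.+ m) (ℤ.+ n) (1ℤ + 1ℤ) eq)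

  +-cancelʳ : ∀ c a b → a + c ≡ b + c → a ≡ b
  +-cancelʳ = AbelianGroup.∙-cancelʳ ℤ.+-0-abelianGroup

  -1+1 : -1ℤ + 1ℤ ≡ 0ℤ
  -1+1 = refl

open IsCommutativeRing isCommutativeRing using
  (+-comm; +-assoc; +-identityˡ; +-identityʳ; *-comm; *-assoc; *-identityˡ; *-identityʳ;
   +-congˡ; +-congʳ; *-congˡ; *-congʳ; distribˡ; distribʳ; zeroˡ; zeroʳ)

open ≡-Reasoning

∑ : {A : Set} → List A → (A → ℤ) → ℤ
∑ []       f = 0ℤ
∑ (x ∷ xs) f = f x + ∑ xs f

module _ {A : Set} where

  ∑-cong : ∀ (xs : List A) {f g : A → ℤ} → (∀ x → f x ≡ g x) → ∑ xs f ≡ ∑ xs g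
  ∑-cong []       eq = refl
  ∑-cong (x ∷ xs) eq = cong₂ _+_ (eq x) (∑-cong xs eq)

  ∑-0 : ∀ (xs : List A) → ∑ xs (λ _ → 0ℤ) ≡ 0ℤ
  ∑-0 []       = refl
  ∑-0 (_ ∷ xs) = trans (+-identityˡ _) (∑-0 xs)

  ∑-+ : ∀ (xs : List A) (f g : A → ℤ) → ∑ xs (λ x → f x + g x) ≡ ∑ xs f + ∑ xs g
  ∑-+ []       f g = sym (+-identityˡ _)
  ∑-+ (x ∷ xs) f g rewrite ∑-+ xs f g = +-interchange (f x) (g x) (∑ xs f) (∑ xs g)

  ∑-*ˡ : ∀ (xs : List A) c (f : A → ℤ) → ∑ xs (λ x → c * f x) ≡ c * ∑ xs f
  ∑-*ˡ []       c f = sym (zeroʳ c)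
  ∑-*ˡ (x ∷ xs) c f rewrite ∑-*ˡ xs c f = sym (distribˡ c (f x) (∑ xs f))

  ∑-*ʳ : ∀ (xs : List A) c (f : A → ℤ) → ∑ xs (λ x → f x * c) ≡ ∑ xs f * c
  ∑-*ʳ xs c f = begin
    ∑ xs (λ x → f x * c) ≡⟨ ∑-cong xs (λ x → *-comm (f x) c) ⟩
    ∑ xs (λ x → c * f x) ≡⟨ ∑-*ˡ xs c f ⟩
    c * ∑ xs f           ≡⟨ *-comm c _ ⟩
    ∑ xs f * c           ∎

  ∑-const : ∀ (xs : List A) c → ∑ xs (λ _ → c) ≡ ℤ.+ length xs * c
  ∑-const []       c = sym (zeroˡ c)
  ∑-const (_ ∷ xs) c rewrite ∑-const xs c = suc-* (length xs) c

  ∑-++ : ∀ (xs ys : List A) (f : A → ℤ) → ∑ (xs ++ ys) f ≡ ∑ xs f + ∑ ys f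
  ∑-++ []       ys f = sym (+-identityˡ _)
  ∑-++ (x ∷ xs) ys f rewrite ∑-++ xs ys f = sym (+-assoc (f x) _ _)

∑-map : ∀ {A B : Set} (g : A → B) xs (f : B → ℤ) → ∑ (map g xs) f ≡ ∑ xs (f ∘ g)
∑-map g []       f = refl
∑-map g (x ∷ xs) f = cong₂ _+_ refl (∑-map g xs f)

∑-swap : ∀ {A B : Set} (xs : List A) (ys : List B) (f : A → B → ℤ) →
         ∑ xs (λ x → ∑ ys (f x)) ≡ ∑ ys (λ y → ∑ xs (λ x → f x y))
∑-swap []       ys f = sym (∑-0 ys)
∑-swap (x ∷ xs) ys f = begin
  ∑ ys (f x) + ∑ xs (λ x → ∑ ys (f x))             ≡⟨ cong₂ _+_ refl (∑-swap xs ys f) ⟩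
  ∑ ys (f x) + ∑ ys (λ y → ∑ xs (λ x → f x y))     ≡⟨ ∑-+ ys _ _ ⟨
  ∑ ys (λ y → f x y + ∑ xs (λ x → f x y))          ∎

⟦_⟧ : {P : Set} → Dec P → ℤ
⟦ p? ⟧ = if does p? then 1ℤ else 0ℤ

⟦⟧-true : {P : Set} (p? : Dec P) → P → ⟦ p? ⟧ ≡ 1ℤ
⟦⟧-true p? p rewrite dec-true p? p = refl

⟦⟧-false : {P : Set} (p? : Dec P) → ¬ P → ⟦ p? ⟧ ≡ 0ℤ
⟦⟧-false p? ¬p rewrite dec-false p? ¬p = refl

⟦⟧-cong : {P Q : Set} (p? : Dec P) (q? : Dec Q) → (P → Q) → (Q → P) → ⟦ p? ⟧ ≡ ⟦ q? ⟧
⟦⟧-cong p? (yes q) to from = ⟦⟧-true p? (from q)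
⟦⟧-cong p? (no ¬q) to from = ⟦⟧-false p? (¬q ∘ to)

⟦⟧-*-cong : {P : Set} (p? : Dec P) {x y : ℤ} → (P → x ≡ y) → ⟦ p? ⟧ * x ≡ ⟦ p? ⟧ * y
⟦⟧-*-cong (yes p) eq = cong (1ℤ *_) (eq p)
⟦⟧-*-cong (no  _) eq = trans (zeroˡ _) (sym (zeroˡ _))

∑-filter : ∀ {A : Set} {P : A → Set} (P? : Decidable P) xs (f : A → ℤ) →
           ∑ (filter P? xs) f ≡ ∑ xs (λ x → ⟦ P? x ⟧ * f x)
∑-filter P? []       f = refl
∑-filter P? (x ∷ xs) f with P? x
... | yes _ = cong₂ _+_ (sym (*-identityˡ _)) (∑-filter P? xs f)
... | no  _ = trans (∑-filter P? xs f) (sym (trans (+-congʳ (zeroˡ (f x))) (+-identityˡ _)))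

length-filter≡∑ : ∀ {A : Set} {P : A → Set} (P? : Decidable P) xs →
                  ℤ.+ length (filter P? xs) ≡ ∑ xs (λ x → ⟦ P? x ⟧)
length-filter≡∑ P? []       = refl
length-filter≡∑ P? (x ∷ xs) with P? x
... | yes _ = trans (pos-+ 1 _) (cong (1ℤ +_) (length-filter≡∑ P? xs))
... | no  _ = trans (length-filter≡∑ P? xs) (sym (+-identityˡ _))

module _ {A : Set} (_≟_ : DecidableEquality A) where

  ∑-δ-∉ : ∀ {a} (xs : List A) (f : A → ℤ) → All (a ≢_) xs → ∑ xs (λ x → ⟦ a ≟ x ⟧ * f x) ≡ 0ℤ
  ∑-δ-∉ []       f []         = refl
  ∑-δ-∉ {a} (x ∷ xs) f (a≢ ∷ a∉) rewrite ⟦⟧-false (a ≟ x) a≢ =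
    trans (cong₂ _+_ (zeroˡ (f x)) (∑-δ-∉ xs f a∉)) (+-identityˡ 0ℤ)

  ∑-δ : ∀ {a} {xs : List A} → Unique xs → a ∈ xs → ∀ (f : A → ℤ) → ∑ xs (λ x → ⟦ a ≟ x ⟧ * f x) ≡ f a
  ∑-δ {a} {_ ∷ xs} (a∉ ∷ _) (here refl) f
    rewrite ⟦⟧-true (a ≟ a) refl =
    trans (cong₂ _+_ (*-identityˡ (f a)) (∑-δ-∉ xs f a∉)) (+-identityʳ (f a))
  ∑-δ {a} {x ∷ xs} (x∉ ∷ u) (there a∈) f
    rewrite ⟦⟧-false (a ≟ x) (≢-sym (All.lookup x∉ a∈)) =
    trans (cong₂ _+_ (zeroˡ (f x)) (∑-δ u a∈ f)) (+-identityˡ (f a))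

  ∑-remove : ∀ {a} {xs : List A} → Unique xs → a ∈ xs → ∀ (f : A → ℤ) →
             ∑ xs f ≡ ∑ (filter (λ x → ¬? (a ≟ x)) xs) f + f a
  ∑-remove {a} {xs} u a∈ f = begin
    ∑ xs f                                                    ≡⟨ ∑-cong xs split ⟩
    ∑ xs (λ x → ⟦ ¬? (a ≟ x) ⟧ * f x + ⟦ a ≟ x ⟧ * f x)       ≡⟨ ∑-+ xs _ _ ⟩
    ∑ xs (λ x → ⟦ ¬? (a ≟ x) ⟧ * f x) + _                     ≡⟨ cong₂ _+_ (sym (∑-filter (λ x → ¬? (a ≟ x)) xs f))
        (∑-δ u a∈ f) ⟩
    ∑ (filter (λ x → ¬? (a ≟ x)) xs) f + f a                  ∎
    where
    split : ∀ x → f x ≡ ⟦ ¬? (a ≟ x) ⟧ * f x + ⟦ a ≟ x ⟧ * f x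
    split x with a ≟ x
    ... | yes _ = sym (trans (cong₂ _+_ (zeroˡ _) (*-identityˡ _)) (+-identityˡ _))
    ... | no  _ = sym (trans (cong₂ _+_ (*-identityˡ _) (zeroˡ _)) (+-identityʳ _))

-- Characters of 𝔽₂ᵈ

infix 4 _≟ᵛ_
opaque
  _≟ᵛ_ : ∀ {d} → DecidableEquality (Vec Bool d)
  _≟ᵛ_ = Vec.≡-dec Bool._≟_

∈-subsets : ∀ {d} (x : Vec Bool d) → x ∈ subsets d
∈-subsets []          = here refl
∈-subsets (true ∷ x)  = ∈-++⁺ˡ (∈-map⁺ (true ∷_) (∈-subsets x))
∈-subsets (false ∷ x) = ∈-++⁺ʳ _ (∈-map⁺ (false ∷_) (∈-subsets x))

subsets-unique : ∀ d → Unique (subsets d)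
subsets-unique zero    = [] ∷ []
subsets-unique (suc d) = Unique.++⁺ (Unique.map⁺ Vec.∷-injectiveʳ (subsets-unique d))
                                    (Unique.map⁺ Vec.∷-injectiveʳ (subsets-unique d)) disjoint
  where
  disjoint : ∀ {x} → ¬ (x ∈ map (true ∷_) (subsets d) × x ∈ map (false ∷_) (subsets d))
  disjoint (p , q) with ∈-map⁻ (true ∷_) p | ∈-map⁻ (false ∷_) q
  ... | _ , _ , refl | _ , _ , ()

length-subsets : ∀ d → length (subsets d) ≡ 2 ℕ.^ d
length-subsets zero    = refl
length-subsets (suc d) = begin
  length (map (true ∷_) (subsets d) ++ map (false ∷_) (subsets d))
    ≡⟨ List.length-++ (map (true ∷_) (subsets d)) ⟩
  length (map (true ∷_) (subsets d)) ℕ.+ length (map (false ∷_) (subsets d))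
    ≡⟨ cong₂ ℕ._+_ (List.length-map _ (subsets d)) (List.length-map _ (subsets d)) ⟩
  length (subsets d) ℕ.+ length (subsets d)
    ≡⟨ cong (λ k → k ℕ.+ k) (length-subsets d) ⟩
  2 ℕ.^ d ℕ.+ 2 ℕ.^ d
    ≡⟨ cong (2 ℕ.^ d ℕ.+_) (ℕ.+-identityʳ _) ⟨
  2 ℕ.^ suc d ∎

∑-subsets-suc : ∀ d f → ∑ (subsets (suc d)) f ≡
                ∑ (subsets d) (f ∘ (true ∷_)) + ∑ (subsets d) (f ∘ (false ∷_))
∑-subsets-suc d f = trans (∑-++ (map (true ∷_) (subsets d)) _ f)
                          (cong₂ _+_ (∑-map (true ∷_) (subsets d) f) (∑-map (false ∷_) (subsets d) f))

infixl 6 _⊕_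
_⊕_ : ∀ {d} → Vec Bool d → Vec Bool d → Vec Bool d
_⊕_ = zipWith _xor_

0ᵛ : ∀ {d} → Vec Bool d
0ᵛ = replicate _ false

⊕-comm : ∀ {d} (x y : Vec Bool d) → x ⊕ y ≡ y ⊕ x
⊕-comm = Vec.zipWith-comm Bool.xor-comm

⊕-assoc : ∀ {d} (x y z : Vec Bool d) → (x ⊕ y) ⊕ z ≡ x ⊕ (y ⊕ z)
⊕-assoc = Vec.zipWith-assoc Bool.xor-assoc

⊕-identityʳ : ∀ {d} (x : Vec Bool d) → x ⊕ 0ᵛ ≡ x
⊕-identityʳ = Vec.zipWith-identityʳ Bool.xor-identityʳ

⊕-self : ∀ {d} (x : Vec Bool d) → x ⊕ x ≡ 0ᵛ
⊕-self []      = refl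
⊕-self (b ∷ x) = cong₂ _∷_ (Bool.xor-same b) (⊕-self x)

⊕≡0⇒≡ : ∀ {d} (x y : Vec Bool d) → 0ᵛ ≡ x ⊕ y → x ≡ y
⊕≡0⇒≡ x y eq = begin
  x           ≡⟨ ⊕-identityʳ x ⟨
  x ⊕ 0ᵛ      ≡⟨ cong (x ⊕_) (⊕-self y) ⟨
  x ⊕ (y ⊕ y) ≡⟨ ⊕-assoc x y y ⟨
  (x ⊕ y) ⊕ y ≡⟨ cong (_⊕ y) eq ⟨
  0ᵛ ⊕ y      ≡⟨ ⊕-comm 0ᵛ y ⟩
  y ⊕ 0ᵛ      ≡⟨ ⊕-identityʳ y ⟩
  y           ∎

infix 7 _∙_
_∙_ : ∀ {d} → Vec Bool d → Vec Bool d → Bool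
[]      ∙ []      = false
(a ∷ x) ∙ (b ∷ y) = (a ∧ b) xor (x ∙ y)

∙-comm : ∀ {d} (x y : Vec Bool d) → x ∙ y ≡ y ∙ x
∙-comm []      []      = refl
∙-comm (a ∷ x) (b ∷ y) = cong₂ _xor_ (Bool.∧-comm a b) (∙-comm x y)

∙-zeroˡ : ∀ {d} (x : Vec Bool d) → 0ᵛ ∙ x ≡ false
∙-zeroˡ []      = refl
∙-zeroˡ (a ∷ x) = ∙-zeroˡ x

∙-zeroʳ : ∀ {d} (x : Vec Bool d) → x ∙ 0ᵛ ≡ false
∙-zeroʳ x = trans (∙-comm x 0ᵛ) (∙-zeroˡ x)

sgn : Bool → ℤ
sgn false = 1ℤ
sgn true  = -1ℤ

sgn-xor : ∀ a b → sgn (a xor b) ≡ sgn a * sgn b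
sgn-xor false b     = sym (*-identityˡ _)
sgn-xor true  false = sym (*-identityʳ _)
sgn-xor true  true  = sym -1*-1

sgn-injective : ∀ a b → sgn a ≡ sgn b → a ≡ b
sgn-injective false false _ = refl
sgn-injective true  true  _ = refl

χ : ∀ {d} → Vec Bool d → Vec Bool d → ℤ
χ x y = sgn (x ∙ y)

χ-comm : ∀ {d} (x y : Vec Bool d) → χ x y ≡ χ y x
χ-comm x y = cong sgn (∙-comm x y)

χ-0ʳ : ∀ {d} (x : Vec Bool d) → χ x 0ᵛ ≡ 1ℤ
χ-0ʳ x = cong sgn (∙-zeroʳ x)

χ-⊕ʳ : ∀ {d} (x y z : Vec Bool d) → χ x (y ⊕ z) ≡ χ x y * χ x z
χ-⊕ʳ []          []      []      = sym (*-identityʳ 1ℤ)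
χ-⊕ʳ (false ∷ x) (b ∷ y) (c ∷ z) = χ-⊕ʳ x y z
χ-⊕ʳ (true ∷ x)  (b ∷ y) (c ∷ z) = begin
  sgn ((b xor c) xor (x ∙ (y ⊕ z)))              ≡⟨ sgn-xor (b xor c) _ ⟩
  sgn (b xor c) * χ x (y ⊕ z)                    ≡⟨ cong₂ _*_ (sgn-xor b c) (χ-⊕ʳ x y z) ⟩
  sgn b * sgn c * (χ x y * χ x z)                ≡⟨ *-interchange (sgn b) (sgn c) _ _ ⟩
  sgn b * χ x y * (sgn c * χ x z)                ≡⟨ cong₂ _*_ (sgn-xor b _) (sgn-xor c _) ⟨
  sgn (b xor x ∙ y) * sgn (c xor x ∙ z)          ∎

χ-⊕ˡ : ∀ {d} (x y z : Vec Bool d) → χ (x ⊕ y) z ≡ χ x z * χ y z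
χ-⊕ˡ x y z = begin
  χ (x ⊕ y) z   ≡⟨ χ-comm (x ⊕ y) z ⟩
  χ z (x ⊕ y)   ≡⟨ χ-⊕ʳ z x y ⟩
  χ z x * χ z y ≡⟨ cong₂ _*_ (χ-comm z x) (χ-comm z y) ⟩
  χ x z * χ y z ∎

χ-square : ∀ {d} (x y : Vec Bool d) → χ x y * χ x y ≡ 1ℤ
χ-square x y = begin
  χ x y * χ x y ≡⟨ χ-⊕ʳ x y y ⟨
  χ x (y ⊕ y)   ≡⟨ cong (χ x) (⊕-self y) ⟩
  χ x 0ᵛ        ≡⟨ χ-0ʳ x ⟩
  1ℤ            ∎

-- Orthogonality of characters: a coordinate of `y` that is `true` gives the two halves of the sum
-- opposite signs, and one that is `false` makes them equal.
∑-χ : ∀ {d} (y : Vec Bool d) → ∑ (subsets d) (λ x → χ x y) ≡ ℤ.+ (2 ℕ.^ d) * ⟦ 0ᵛ ≟ᵛ y ⟧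
∑-χ []          = trans (+-identityʳ 1ℤ) (trans (sym (*-identityʳ 1ℤ)) (*-congˡ (sym (⟦⟧-true ([] ≟ᵛ []) refl))))
∑-χ {suc d} (b ∷ y) = trans (∑-subsets-suc d _) (halves b)
  where
  halves : ∀ b → ∑ (subsets d) (λ x → χ (true ∷ x) (b ∷ y)) + ∑ (subsets d) (λ x → χ x y)
           ≡ ℤ.+ (2 ℕ.^ suc d) * ⟦ 0ᵛ ≟ᵛ (b ∷ y) ⟧
  halves false = begin
    ∑ (subsets d) (λ x → χ x y) + ∑ (subsets d) (λ x → χ x y) ≡⟨ cong (λ z → z + z) (∑-χ y) ⟩
    2ᵈ * δ + 2ᵈ * δ                                           ≡⟨ distribʳ δ 2ᵈ 2ᵈ ⟨
    (2ᵈ + 2ᵈ) * δ                                             ≡⟨ cong (_* δ) double ⟩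
    ℤ.+ (2 ℕ.^ suc d) * δ                                     ≡⟨ *-congˡ
        (⟦⟧-cong (0ᵛ ≟ᵛ y) (0ᵛ ≟ᵛ (false ∷ y)) (cong (false ∷_)) Vec.∷-injectiveʳ) ⟩
    ℤ.+ (2 ℕ.^ suc d) * ⟦ 0ᵛ ≟ᵛ (false ∷ y) ⟧                 ∎
    where
    δ = ⟦ 0ᵛ ≟ᵛ y ⟧
    2ᵈ = ℤ.+ (2 ℕ.^ d)
    double : 2ᵈ + 2ᵈ ≡ ℤ.+ (2 ℕ.^ suc d)
    double = trans (sym (pos-+ _ _)) (cong (λ k → ℤ.+ (2 ℕ.^ d ℕ.+ k)) (sym (ℕ.+-identityʳ _)))
  halves true = begin
    ∑ (subsets d) (λ x → sgn (true xor x ∙ y)) + ∑ (subsets d) (λ x → χ x y)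
      ≡⟨ +-congʳ (trans (∑-cong (subsets d) (λ x → sgn-xor true (x ∙ y))) (∑-*ˡ (subsets d) -1ℤ _)) ⟩
    -1ℤ * ∑ (subsets d) (λ x → χ x y) + ∑ (subsets d) (λ x → χ x y)
      ≡⟨ -1*a+a _ ⟩
    0ℤ                                  ≡⟨ zeroʳ (ℤ.+ (2 ℕ.^ suc d)) ⟨
    ℤ.+ (2 ℕ.^ suc d) * 0ℤ              ≡⟨ *-congˡ (⟦⟧-false (0ᵛ ≟ᵛ (true ∷ y)) λ ()) ⟨
    ℤ.+ (2 ℕ.^ suc d) * ⟦ 0ᵛ ≟ᵛ (true ∷ y) ⟧ ∎

-- Twisted symplectic forms

∑-cartesianProduct : ∀ {A B : Set} (xs : List A) (ys : List B) (f : A × B → ℤ) →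
                     ∑ (cartesianProduct xs ys) f ≡ ∑ xs (λ x → ∑ ys (λ y → f (x , y)))
∑-cartesianProduct []       ys f = refl
∑-cartesianProduct (x ∷ xs) ys f =
  trans (∑-++ (map (x ,_) ys) _ f) (cong₂ _+_ (∑-map (x ,_) ys f) (∑-cartesianProduct xs ys f))

∑-product : ∀ {A B : Set} (xs : List A) (ys : List B) (f : A → ℤ) (g : B → ℤ) →
            ∑ xs (λ x → ∑ ys (λ y → f x * g y)) ≡ ∑ xs f * ∑ ys g
∑-product xs ys f g = trans (∑-cong xs (λ x → ∑-*ˡ ys (f x) g)) (∑-*ʳ xs (∑ ys g) f)

⟦⟧-* : {P Q R : Set} (p? : Dec P) (q? : Dec Q) (r? : Dec R) →
       (P → Q → R) → (R → P) → (R → Q) → ⟦ p? ⟧ * ⟦ q? ⟧ ≡ ⟦ r? ⟧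
⟦⟧-* (yes p) (yes q) r? to _ _ = trans (*-identityˡ _) (sym (⟦⟧-true r? (to p q)))
⟦⟧-* (no ¬p) q?      r? _ f _  = trans (zeroˡ _) (sym (⟦⟧-false r? (¬p ∘ f)))
⟦⟧-* (yes _) (no ¬q) r? _ _ g  = trans (zeroʳ _) (sym (⟦⟧-false r? (¬q ∘ g)))

Point : ℕ → Set
Point d = Vec Bool d × Vec Bool d

infix 4 _≟ₚ_
opaque
  _≟ₚ_ : ∀ {d} → DecidableEquality (Point d)
  _≟ₚ_ = Product.≡-dec _≟ᵛ_ _≟ᵛ_

-- form (λ x → x) is the symplectic form, because the twist is by σ over b = 0
-- and by the identity elsewhere.
twist : ∀ {d} → (Vec Bool d → Vec Bool d) → Vec Bool d → Vec Bool d → Vec Bool d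
twist σ b c = if does (0ᵛ ≟ᵛ b) then σ c else c

form : ∀ {d} → (Vec Bool d → Vec Bool d) → Point d → Point d → Bool
form σ (a , b) (a′ , b′) = (a ∙ twist σ b b′) xor (a′ ∙ twist σ b′ b)

-- Surjectivity is recorded in the form in which it acts, as reindexing of sums over the whole
-- space.
record Permutation {d} (σ : Vec Bool d → Vec Bool d) : Set where
  field
    injective  : ∀ x y → σ x ≡ σ y → x ≡ y
    preserves0 : σ 0ᵛ ≡ 0ᵛ
    ∑-∘        : ∀ f → ∑ (subsets d) (f ∘ σ) ≡ ∑ (subsets d) f

points : ∀ d → List (Point d)
points d = cartesianProduct (subsets d) (subsets d)

form-sym : ∀ {d} σ (x y : Point d) → form σ x y ≡ form σ y x
form-sym σ (a , b) (a′ , b′) = Bool.xor-comm (a ∙ _) _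

form-self : ∀ {d} σ (x : Point d) → form σ x x ≡ false
form-self σ (a , b) = Bool.xor-same (a ∙ _)

module Hadamard {d} {σ : Vec Bool d → Vec Bool d} (perm : Permutation σ) where
  open Permutation perm

  private
    t : Vec Bool d → Vec Bool d → Vec Bool d
    t = twist σ
    V = subsets d
    n = ℤ.+ (2 ℕ.^ d)

  t-id : ∀ {b} c → b ≢ 0ᵛ → t b c ≡ c
  t-id {b} c b≢0 with 0ᵛ ≟ᵛ b
  ... | yes 0≡b = contradiction (sym 0≡b) b≢0
  ... | no  _   = refl

  t-injective : ∀ b {x y} → t b x ≡ t b y → x ≡ y
  t-injective b eq with 0ᵛ ≟ᵛ b
  ... | yes _ = injective _ _ eq
  ... | no  _ = eq

  t-0 : ∀ b → t b 0ᵛ ≡ 0ᵛ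
  t-0 b with 0ᵛ ≟ᵛ b
  ... | yes _ = preserves0
  ... | no  _ = refl

  ∑-t : ∀ b f → ∑ V (f ∘ t b) ≡ ∑ V f
  ∑-t b f with 0ᵛ ≟ᵛ b
  ... | yes _ = ∑-∘ f
  ... | no  _ = refl

  S : Point d → Point d → ℤ
  S x y = sgn (form σ x y)

  S-split : ∀ a b a′ b′ → S (a , b) (a′ , b′) ≡ χ a (t b b′) * χ a′ (t b′ b)
  S-split a b a′ b′ = sgn-xor (a ∙ t b b′) (a′ ∙ t b′ b)

  S-zero : ∀ x → S x (0ᵛ , 0ᵛ) ≡ 1ℤ
  S-zero (a , b) = cong sgn (cong₂ _xor_ (trans (cong (a ∙_) (t-0 b)) (∙-zeroʳ a)) (∙-zeroˡ (t 0ᵛ b)))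

  -- The Hadamard property. For a fixed second coordinate `c` of `z`, summing over its first
  -- coordinate forces `t c b ≡ t c b′`, hence `b ≡ b′` by injectivity. What remains is a character
  -- sum along `t b`, which reindexing turns into the untwisted one.
  ∑-S-S : ∀ x y → ∑ (points d) (λ z → S x z * S y z) ≡ n * n * ⟦ x ≟ₚ y ⟧
  ∑-S-S x@(a , b) y@(a′ , b′) = begin
    ∑ (points d) (λ z → S x z * S y z)
      ≡⟨ ∑-cartesianProduct V V _ ⟩
    ∑ V (λ e → ∑ V (λ c → S x (e , c) * S y (e , c)))
      ≡⟨ ∑-swap V V _ ⟩
    ∑ V (λ c → ∑ V (λ e → S x (e , c) * S y (e , c)))
      ≡⟨ ∑-cong V (λ c → ∑-cong V (λ e → separate e c)) ⟩
    ∑ V (λ c → ∑ V (λ e → k c * χ e (t c b ⊕ t c b′)))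
      ≡⟨ ∑-cong V (λ c → trans (∑-*ˡ V (k c) _) (cong (k c *_) (trans (∑-χ (t c b ⊕ t c b′)) (cong (n *_) (kernel c))))) ⟩
    ∑ V (λ c → k c * (n * ⟦ b ≟ᵛ b′ ⟧))
      ≡⟨ ∑-*ʳ V _ k ⟩
    ∑ V k * (n * ⟦ b ≟ᵛ b′ ⟧)
      ≡⟨ *-comm _ _ ⟩
    n * ⟦ b ≟ᵛ b′ ⟧ * ∑ V k
      ≡⟨ trans (*-congʳ (*-comm _ _)) (*-assoc _ _ _) ⟩
    ⟦ b ≟ᵛ b′ ⟧ * (n * ∑ V k)
      ≡⟨ ⟦⟧-*-cong (b ≟ᵛ b′) (λ b≡b′ → cong (n *_) (∑-k b≡b′)) ⟩
    ⟦ b ≟ᵛ b′ ⟧ * (n * (n * ⟦ a ≟ᵛ a′ ⟧))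
      ≡⟨ *-congˡ (sym (*-assoc n n _)) ⟩
    ⟦ b ≟ᵛ b′ ⟧ * (n * n * ⟦ a ≟ᵛ a′ ⟧)
      ≡⟨ trans (*-comm _ _) (*-assoc (n * n) _ _) ⟩
    n * n * (⟦ a ≟ᵛ a′ ⟧ * ⟦ b ≟ᵛ b′ ⟧)
      ≡⟨ cong (n * n *_) (⟦⟧-* (a ≟ᵛ a′) (b ≟ᵛ b′) (x ≟ₚ y) (cong₂ _,_) (cong proj₁) (cong proj₂)) ⟩
    n * n * ⟦ x ≟ₚ y ⟧ ∎
    where
    k : Vec Bool d → ℤ
    k c = χ a (t b c) * χ a′ (t b′ c)

    separate : ∀ e c → S x (e , c) * S y (e , c) ≡ k c * χ e (t c b ⊕ t c b′)
    separate e c = begin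
      S x (e , c) * S y (e , c)
        ≡⟨ cong₂ _*_ (S-split a b e c) (S-split a′ b′ e c) ⟩
      χ a (t b c) * χ e (t c b) * (χ a′ (t b′ c) * χ e (t c b′))
        ≡⟨ *-interchange _ _ _ _ ⟩
      k c * (χ e (t c b) * χ e (t c b′))
        ≡⟨ cong (k c *_) (sym (χ-⊕ʳ e _ _)) ⟩
      k c * χ e (t c b ⊕ t c b′) ∎

    kernel : ∀ c → ⟦ 0ᵛ ≟ᵛ (t c b ⊕ t c b′) ⟧ ≡ ⟦ b ≟ᵛ b′ ⟧
    kernel c = ⟦⟧-cong (0ᵛ ≟ᵛ (t c b ⊕ t c b′)) (b ≟ᵛ b′) (λ eq → t-injective c (⊕≡0⇒≡ _ _ eq))
                       (λ { refl → sym (⊕-self (t c b)) })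

    ∑-k : b ≡ b′ → ∑ V k ≡ n * ⟦ a ≟ᵛ a′ ⟧
    ∑-k refl = begin
      ∑ V k                            ≡⟨ ∑-cong V (λ c → sym (χ-⊕ˡ a a′ (t b c))) ⟩
      ∑ V (λ c → χ (a ⊕ a′) (t b c))   ≡⟨ ∑-t b (χ (a ⊕ a′)) ⟩
      ∑ V (χ (a ⊕ a′))                 ≡⟨ ∑-cong V (χ-comm (a ⊕ a′)) ⟩
      ∑ V (λ c → χ c (a ⊕ a′))         ≡⟨ ∑-χ (a ⊕ a′) ⟩
      n * ⟦ 0ᵛ ≟ᵛ (a ⊕ a′) ⟧           ≡⟨ cong (n *_) (⟦⟧-cong (0ᵛ ≟ᵛ (a ⊕ a′)) (a ≟ᵛ a′) (⊕≡0⇒≡ a a′)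
          (λ { refl → sym (⊕-self a) })) ⟩
      n * ⟦ a ≟ᵛ a′ ⟧                  ∎

  -- The two linear conditions left over by the sums over the first
  -- coordinates have the single solution c = h = b ⊕ b′.
  solution : ∀ b b′ c h → 0ᵛ ≡ (t c b ⊕ t c b′) ⊕ t c h → 0ᵛ ≡ (t h b ⊕ t h b′) ⊕ t h c →
             b ⊕ b′ ≡ c × b ⊕ b′ ≡ h
  solution b b′ c h eq₁ eq₂ with c ≟ᵛ 0ᵛ | h ≟ᵛ 0ᵛ
  ... | no c≢0 | no h≢0 = β≡c , β≡h
    where
    β≡h : b ⊕ b′ ≡ h
    β≡h rewrite t-id b c≢0 | t-id b′ c≢0 | t-id h c≢0 = ⊕≡0⇒≡ _ _ eq₁
    β≡c : b ⊕ b′ ≡ c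
    β≡c rewrite t-id b h≢0 | t-id b′ h≢0 | t-id c h≢0 = ⊕≡0⇒≡ _ _ eq₂
  ... | yes refl | yes refl = β≡0 , β≡0
    where
    b≡b′ : b ≡ b′
    b≡b′ = t-injective 0ᵛ (⊕≡0⇒≡ _ _ (trans eq₁ (trans (cong₂ _⊕_ refl (t-0 0ᵛ)) (⊕-identityʳ _))))
    β≡0 : b ⊕ b′ ≡ 0ᵛ
    β≡0 = trans (cong (_⊕ b′) b≡b′) (⊕-self b′)
  ... | yes refl | no h≢0 = contradiction (t-injective 0ᵛ (trans h≡0 (sym (t-0 0ᵛ)))) h≢0
    where
    b≡b′ : b ≡ b′
    b≡b′ = t-injective h (⊕≡0⇒≡ _ _ (trans eq₂ (trans (cong₂ _⊕_ refl (t-0 h)) (⊕-identityʳ _))))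
    h≡0 : t 0ᵛ h ≡ 0ᵛ
    h≡0 rewrite b≡b′ = sym (trans (sym (⊕-self (t 0ᵛ b′))) (⊕≡0⇒≡ _ _ eq₁))
  ... | no c≢0 | yes refl = contradiction (t-injective 0ᵛ (trans c≡0 (sym (t-0 0ᵛ)))) c≢0
    where
    b≡b′ : b ≡ b′
    b≡b′ = t-injective c (⊕≡0⇒≡ _ _ (trans eq₁ (trans (cong₂ _⊕_ refl (t-0 c)) (⊕-identityʳ _))))
    c≡0 : t 0ᵛ c ≡ 0ᵛ
    c≡0 rewrite b≡b′ = sym (trans (sym (⊕-self (t 0ᵛ b′))) (⊕≡0⇒≡ _ _ eq₂))

  ⊕-solves : ∀ b b′ → 0ᵛ ≡ (t (b ⊕ b′) b ⊕ t (b ⊕ b′) b′) ⊕ t (b ⊕ b′) (b ⊕ b′)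
  ⊕-solves b b′ with b ⊕ b′ ≟ᵛ 0ᵛ
  ... | no β≢0 rewrite t-id b β≢0 | t-id b′ β≢0 | t-id (b ⊕ b′) β≢0 = sym (⊕-self (b ⊕ b′))
  ... | yes β≡0 rewrite ⊕≡0⇒≡ b b′ (sym β≡0) | ⊕-self b′ | ⊕-self (t 0ᵛ b′) | t-0 0ᵛ = sym (⊕-self 0ᵛ)

  -- With the second coordinates `c` and `h` of `z` and `w` held fixed, the summand factors into
  -- characters of the two first coordinates. Their sums leave the two conditions of `solution`, so
  -- a single term survives, the same one as for the untwisted symplectic form.
  ∑-S⁵ : ∀ x y → ∑ (points d) (λ z → ∑ (points d) (λ w → S x z * S y z * (S x w * S y w) * S z w)) ≡ n * n
  ∑-S⁵ x@(a , b) y@(a′ , b′) = begin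
    ∑ (points d) (λ z → ∑ (points d) (λ w → T z w))
      ≡⟨ trans (∑-cartesianProduct V V _) (∑-cong V (λ e → ∑-cong V (λ c → ∑-cartesianProduct V V _))) ⟩
    ∑ V (λ e → ∑ V (λ c → ∑ V (λ g → ∑ V (λ h → T (e , c) (g , h)))))
      ≡⟨ trans (∑-swap V V _) (∑-cong V (λ c → ∑-cong V (λ e → ∑-swap V V _))) ⟩
    ∑ V (λ c → ∑ V (λ e → ∑ V (λ h → ∑ V (λ g → T (e , c) (g , h)))))
      ≡⟨ ∑-cong V (λ c → ∑-swap V V _) ⟩
    ∑ V (λ c → ∑ V (λ h → ∑ V (λ e → ∑ V (λ g → T (e , c) (g , h)))))
      ≡⟨ ∑-cong V (λ c → ∑-cong V (λ h → inner c h)) ⟩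
    ∑ V (λ c → ∑ V (λ h → ⟦ β ≟ᵛ c ⟧ * (⟦ β ≟ᵛ h ⟧ * (n * n * k c h))))
      ≡⟨ ∑-cong V (λ c → ∑-*ˡ V ⟦ β ≟ᵛ c ⟧ _) ⟩
    ∑ V (λ c → ⟦ β ≟ᵛ c ⟧ * ∑ V (λ h → ⟦ β ≟ᵛ h ⟧ * (n * n * k c h)))
      ≡⟨ ∑-δ _≟ᵛ_ (subsets-unique d) (∈-subsets β) (λ c → ∑ V (λ h → ⟦ β ≟ᵛ h ⟧ * (n * n * k c h))) ⟩
    ∑ V (λ h → ⟦ β ≟ᵛ h ⟧ * (n * n * k β h))
      ≡⟨ ∑-δ _≟ᵛ_ (subsets-unique d) (∈-subsets β) (λ h → n * n * k β h) ⟩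
    -- At `c = h = β` the remaining factor is a product of two squared signs.
    n * n * k β β
      ≡⟨ trans (cong (n * n *_) k-square) (*-identityʳ _) ⟩
    n * n ∎
    where
    β = b ⊕ b′

    T : Point d → Point d → ℤ
    T z w = S x z * S y z * (S x w * S y w) * S z w

    k : Vec Bool d → Vec Bool d → ℤ
    k c h = χ a (t b c) * χ a′ (t b′ c) * (χ a (t b h) * χ a′ (t b′ h))

    k-square : k β β ≡ 1ℤ
    k-square = trans (*-interchange _ _ _ _) (trans (cong₂ _*_ (χ-square a _) (χ-square a′ _)) (*-identityʳ 1ℤ))

    u : Vec Bool d → Vec Bool d → Vec Bool d
    u c h = (t c b ⊕ t c b′) ⊕ t c h

    χ-u : ∀ e c h → χ e (u c h) ≡ χ e (t c b) * χ e (t c b′) * χ e (t c h)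
    χ-u e c h = trans (χ-⊕ʳ e _ _) (*-congʳ (χ-⊕ʳ e _ _))

    separate : ∀ e c g h → T (e , c) (g , h) ≡ k c h * (χ e (u c h) * χ g (u h c))
    separate e c g h = begin
      T (e , c) (g , h)
        ≡⟨ cong₂ _*_ (cong₂ _*_ (cong₂ _*_ (S-split a b e c) (S-split a′ b′ e c))
                                (cong₂ _*_ (S-split a b g h) (S-split a′ b′ g h))) (S-split e c g h) ⟩
      _ ≡⟨ *-collect₁₀ _ _ _ _ _ _ _ _ _ _ ⟩
      _ ≡⟨ cong (k c h *_) (cong₂ _*_ (χ-u e c h) (χ-u g h c)) ⟨
      k c h * (χ e (u c h) * χ g (u h c)) ∎

    kernel : ∀ c h → ⟦ 0ᵛ ≟ᵛ u c h ⟧ * ⟦ 0ᵛ ≟ᵛ u h c ⟧ ≡ ⟦ β ≟ᵛ c ⟧ * ⟦ β ≟ᵛ h ⟧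
    kernel c h = trans
      (⟦⟧-* (0ᵛ ≟ᵛ u c h) (0ᵛ ≟ᵛ u h c) ((β ≟ᵛ c) ×-dec (β ≟ᵛ h)) (solution b b′ c h)
        (λ { (refl , refl) → ⊕-solves b b′ }) (λ { (refl , refl) → ⊕-solves b b′ }))
      (sym (⟦⟧-* (β ≟ᵛ c) (β ≟ᵛ h) ((β ≟ᵛ c) ×-dec (β ≟ᵛ h)) _,_ proj₁ proj₂))

    inner : ∀ c h → ∑ V (λ e → ∑ V (λ g → T (e , c) (g , h))) ≡
                    ⟦ β ≟ᵛ c ⟧ * (⟦ β ≟ᵛ h ⟧ * (n * n * k c h))
    inner c h = begin
      ∑ V (λ e → ∑ V (λ g → T (e , c) (g , h)))
        ≡⟨ ∑-cong V (λ e → trans (∑-cong V (λ g → separate e c g h)) (∑-*ˡ V (k c h) _)) ⟩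
      ∑ V (λ e → k c h * ∑ V (λ g → χ e (u c h) * χ g (u h c)))
        ≡⟨ ∑-*ˡ V (k c h) _ ⟩
      k c h * ∑ V (λ e → ∑ V (λ g → χ e (u c h) * χ g (u h c)))
        ≡⟨ cong (k c h *_) (trans (∑-product V V _ _) (cong₂ _*_ (∑-χ (u c h)) (∑-χ (u h c)))) ⟩
      k c h * (n * ⟦ 0ᵛ ≟ᵛ u c h ⟧ * (n * ⟦ 0ᵛ ≟ᵛ u h c ⟧))
        ≡⟨ cong (k c h *_) (trans (*-interchange n _ n _) (trans (cong (n * n *_) (kernel c h)) (*-interchange n n _ _))) ⟩
      k c h * (n * ⟦ β ≟ᵛ c ⟧ * (n * ⟦ β ≟ᵛ h ⟧))
        ≡⟨ *-pull n _ _ (k c h) ⟩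
      ⟦ β ≟ᵛ c ⟧ * (⟦ β ≟ᵛ h ⟧ * (n * n * k c h)) ∎

-- The 4-vertex condition from three moments

data Relation : Set where
  same edge nonedge : Relation

_≟ʳ_ : DecidableEquality Relation
same    ≟ʳ same    = yes refl
same    ≟ʳ edge    = no λ ()
same    ≟ʳ nonedge = no λ ()
edge    ≟ʳ same    = no λ ()
edge    ≟ʳ edge    = yes refl
edge    ≟ʳ nonedge = no λ ()
nonedge ≟ʳ same    = no λ ()
nonedge ≟ʳ edge    = no λ ()
nonedge ≟ʳ nonedge = yes refl

opaque
  relations : List Relation
  relations = same ∷ edge ∷ nonedge ∷ []

  relations-unique : Unique relations
  relations-unique = ((λ ()) ∷ (λ ()) ∷ []) ∷ ((λ ()) ∷ []) ∷ [] ∷ []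

  ∈-relations : ∀ r → r ∈ relations
  ∈-relations same    = here refl
  ∈-relations edge    = there (here refl)
  ∈-relations nonedge = there (there (here refl))

  ∑-relations : ∀ f → ∑ relations f ≡ f same + (f edge + f nonedge)
  ∑-relations f = +-congˡ (+-congˡ (+-identityʳ _))

isEdge : Relation → Bool
isEdge same    = false
isEdge edge    = true
isEdge nonedge = false

opaque
  rel : ∀ {n} → Graph n → Fin n → Fin n → Relation
  rel G x y = if does (x Fin.≟ y) then same else (if adj G x y then edge else nonedge)

indicator : Bool → ℤ
indicator b = if b then 1ℤ else 0ℤ

adjacency : Relation → ℤ
adjacency r = indicator (isEdge r)

module _ {n} (G : Graph n) where
  opaque
    unfolding rel

    rel-same : ∀ x → rel G x x ≡ same
    rel-same x rewrite dec-true (x Fin.≟ x) refl = refl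

    rel-≢ : ∀ {x y} → x ≢ y → rel G x y ≡ (if adj G x y then edge else nonedge)
    rel-≢ {x} {y} x≢y rewrite dec-false (x Fin.≟ y) x≢y = refl

    rel≡same⇒≡ : ∀ {x y} → rel G x y ≡ same → x ≡ y
    rel≡same⇒≡ {x} {y} eq with x Fin.≟ y
    ... | yes x≡y = x≡y
    ... | no  _ with adj G x y | eq
    ...   | true  | ()
    ...   | false | ()

    rel-sym : ∀ x y → rel G x y ≡ rel G y x
    rel-sym x y with x Fin.≟ y
    ... | yes refl = sym (rel-same x)
    ... | no x≢y   = trans (cong (λ b → if b then edge else nonedge) (Graph.sym G x y)) (sym (rel-≢ (≢-sym x≢y)))

    adj≡isEdge : ∀ x y → adj G x y ≡ isEdge (rel G x y)
    adj≡isEdge x y with x Fin.≟ y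
    ... | yes refl = Graph.irrefl G x
    ... | no _ with adj G x y
    ...   | true  = refl
    ...   | false = refl

∏ : ∀ {k} → Vec (Relation → ℤ) k → Vec Relation k → ℤ
∏ []       []       = 1ℤ
∏ (f ∷ fs) (r ∷ rs) = f r * ∏ fs rs

module _ {A : Set} where

  infix 8 _at_
  _at_ : ∀ {k} → Vec (A → Relation) k → A → Vec Relation k
  rs at i = Vec.map (λ r → r i) rs

  -- Any function of finitely many relations is a combination of products of one-variable functions.
  -- The induction peels off one relation at a time: its point indicators are absorbed into the
  -- weights `g` and `g′`.
  ∑-multilinear : ∀ (xs : List A) {k} (rs rs′ : Vec (A → Relation) k) (g g′ : A → ℤ) →
    (∀ fs → ∑ xs (λ i → g i * ∏ fs (rs at i)) ≡ ∑ xs (λ i → g′ i * ∏ fs (rs′ at i))) →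
    ∀ (F : Vec Relation k → ℤ) → ∑ xs (λ i → g i * F (rs at i)) ≡ ∑ xs (λ i → g′ i * F (rs′ at i))
  ∑-multilinear xs []       []         g g′ eq F = begin
    ∑ xs (λ i → g i * F [])     ≡⟨ ∑-*ʳ xs (F []) g ⟩
    ∑ xs g * F []               ≡⟨ cong (_* F []) (trans (∑-cong xs (λ i → sym (*-identityʳ (g i))))
        (trans (eq []) (∑-cong xs (λ i → *-identityʳ (g′ i))))) ⟩
    ∑ xs g′ * F []              ≡⟨ ∑-*ʳ xs (F []) g′ ⟨
    ∑ xs (λ i → g′ i * F [])    ∎
  ∑-multilinear xs (r ∷ rs) (r′ ∷ rs′) g g′ eq F = begin
    ∑ xs (λ i → g i * F (r i ∷ rs at i))
      ≡⟨ split r rs g ⟩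
    ∑ relations (λ ρ → ∑ xs (λ i → g i * ⟦ r i ≟ʳ ρ ⟧ * F (ρ ∷ rs at i)))
      ≡⟨ ∑-cong relations (λ ρ → ∑-multilinear xs rs rs′ _ _ (restrict ρ) (λ ρs → F (ρ ∷ ρs))) ⟩
    ∑ relations (λ ρ → ∑ xs (λ i → g′ i * ⟦ r′ i ≟ʳ ρ ⟧ * F (ρ ∷ rs′ at i)))
      ≡⟨ split r′ rs′ g′ ⟨
    ∑ xs (λ i → g′ i * F (r′ i ∷ rs′ at i)) ∎
    where
    split : ∀ r rs g → ∑ xs (λ i → g i * F (r i ∷ rs at i)) ≡
            ∑ relations (λ ρ → ∑ xs (λ i → g i * ⟦ r i ≟ʳ ρ ⟧ * F (ρ ∷ rs at i)))
    split r rs g = begin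
      ∑ xs (λ i → g i * F (r i ∷ rs at i))
        ≡⟨ ∑-cong xs (λ i → *-congˡ (∑-δ _≟ʳ_ relations-unique (∈-relations (r i)) (λ ρ → F (ρ ∷ rs at i)))) ⟨
      ∑ xs (λ i → g i * ∑ relations (λ ρ → ⟦ r i ≟ʳ ρ ⟧ * F (ρ ∷ rs at i)))
        ≡⟨ ∑-cong xs (λ i → ∑-*ˡ relations (g i) (λ ρ → ⟦ r i ≟ʳ ρ ⟧ * F (ρ ∷ rs at i))) ⟨
      ∑ xs (λ i → ∑ relations (λ ρ → g i * (⟦ r i ≟ʳ ρ ⟧ * F (ρ ∷ rs at i))))
        ≡⟨ ∑-cong xs (λ i → ∑-cong relations (λ ρ → *-assoc _ _ _)) ⟨
      ∑ xs (λ i → ∑ relations (λ ρ → g i * ⟦ r i ≟ʳ ρ ⟧ * F (ρ ∷ rs at i)))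
        ≡⟨ ∑-swap xs relations _ ⟩
      _ ∎

    restrict : ∀ ρ fs → ∑ xs (λ i → g i * ⟦ r i ≟ʳ ρ ⟧ * ∏ fs (rs at i)) ≡
                        ∑ xs (λ i → g′ i * ⟦ r′ i ≟ʳ ρ ⟧ * ∏ fs (rs′ at i))
    restrict ρ fs = begin
      _ ≡⟨ ∑-cong xs (λ i → *-assoc (g i) _ _) ⟩
      _ ≡⟨ eq ((λ r → ⟦ r ≟ʳ ρ ⟧) ∷ fs) ⟩
      _ ≡⟨ ∑-cong xs (λ i → *-assoc (g′ i) _ _) ⟨
      _ ∎

-- Linearity is witnessed by coefficients on the three relations, since functions that agree
-- pointwise need not be propositionally equal here and additivity alone would not give the
-- expansion.
record Linear (L : (Relation → ℤ) → ℤ) : Set where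
  field
    coeff  : Relation → ℤ
    expand : ∀ f → L f ≡ ∑ relations (λ r → f r * coeff r)

open Linear

linear-eval : ∀ r → Linear (λ f → f r)
linear-eval r .coeff ρ  = ⟦ r ≟ʳ ρ ⟧
linear-eval r .expand f = sym (trans (∑-cong relations (λ ρ → *-comm (f ρ) _))
                                     (∑-δ _≟ʳ_ relations-unique (∈-relations r) f))

linear-*ʳ : ∀ {L} c → Linear L → Linear (λ f → L f * c)
linear-*ʳ c ℓ .coeff r  = ℓ .coeff r * c
linear-*ʳ c ℓ .expand f = trans (*-congʳ (ℓ .expand f))
  (sym (trans (∑-cong relations (λ r → sym (*-assoc (f r) _ c))) (∑-*ʳ relations c _)))

linear-*ˡ : ∀ {L} c → Linear L → Linear (λ f → c * L f)
linear-*ˡ c ℓ .coeff     = linear-*ʳ c ℓ .coeff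
linear-*ˡ c ℓ .expand f  = trans (*-comm c _) (linear-*ʳ c ℓ .expand f)

linear-∑ : ∀ {A : Set} (xs : List A) {L : A → (Relation → ℤ) → ℤ} →
           (∀ x → Linear (L x)) → Linear (λ f → ∑ xs (λ x → L x f))
linear-∑ xs ℓ .coeff r  = ∑ xs (λ x → ℓ x .coeff r)
linear-∑ xs ℓ .expand f = trans (∑-cong xs (λ x → ℓ x .expand f))
  (trans (∑-swap xs relations _) (∑-cong relations (λ r → ∑-*ˡ xs (f r) _)))

I : Relation → ℤ
I r = ⟦ same ≟ʳ r ⟧

J : Relation → ℤ
J _ = 1ℤ

module Basis (s : Relation → ℤ) (s-separates : s edge ≢ s nonedge) where

  -- `I`, `J` and `s` span the functions on `Relation` over the rationals, though not always over
  -- the integers. Agreement on them still suffices: `I` isolates the coefficient of `same`, and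
  -- eliminating between `J` and `s` leaves a multiple of `s edge - s nonedge`, which is nonzero and
  -- can be cancelled.
  linear-ext : ∀ {L L′} → Linear L → Linear L′ → L I ≡ L′ I → L J ≡ L′ J → L s ≡ L′ s → ∀ f → L f ≡ L′ f
  linear-ext {L} {L′} ℓ ℓ′ eqI eqJ eqs f = begin
    L f                                   ≡⟨ ℓ .expand f ⟩
    ∑ relations (λ r → f r * ℓ .coeff r)  ≡⟨ ∑-cong relations (λ r → cong (f r *_) (coeff≡ r)) ⟩
    ∑ relations (λ r → f r * ℓ′ .coeff r) ≡⟨ ℓ′ .expand f ⟨
    L′ f                                  ∎
    where
    c c′ : Relation → ℤ
    c  = ℓ .coeff
    c′ = ℓ′ .coeff

    at-same : c same ≡ c′ same
    at-same = trans (sym (pick ℓ)) (trans eqI (pick ℓ′))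
      where
      pick : ∀ {L} (ℓ : Linear L) → L I ≡ ℓ .coeff same
      pick ℓ = trans (ℓ .expand I) (∑-δ _≟ʳ_ relations-unique (∈-relations same) (ℓ .coeff))

    rest : ∀ g → L g ≡ L′ g → g edge * c edge + g nonedge * c nonedge ≡ g edge * c′ edge + g nonedge * c′ nonedge
    rest g eq = +-cancelˡ (g same * c same) _ _ (begin
      g same * c same + (g edge * c edge + g nonedge * c nonedge)       ≡⟨ pad ℓ ⟨
      L g                                                               ≡⟨ eq ⟩
      L′ g                                                              ≡⟨ pad ℓ′ ⟩
      g same * c′ same + (g edge * c′ edge + g nonedge * c′ nonedge)    ≡⟨ +-congʳ (*-congˡ (sym at-same)) ⟩
      g same * c same + (g edge * c′ edge + g nonedge * c′ nonedge)     ∎)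
      where
      pad : ∀ {L} (ℓ : Linear L) → L g ≡ g same * ℓ .coeff same + (g edge * ℓ .coeff edge + g nonedge * ℓ .coeff nonedge)
      pad ℓ = trans (ℓ .expand g) (∑-relations _)

    eqJ′ : c edge + c nonedge ≡ c′ edge + c′ nonedge
    eqJ′ = subst₂ _≡_ (cong₂ _+_ (*-identityˡ _) (*-identityˡ _)) (cong₂ _+_ (*-identityˡ _) (*-identityˡ _)) (rest J eqJ)

    at-edge : c edge ≡ c′ edge
    at-edge = *-solve₂ _ _ _ _ _ _ s-separates eqJ′ (rest s eqs)

    coeff≡ : ∀ r → c r ≡ c′ r
    coeff≡ same    = at-same
    coeff≡ edge    = at-edge
    coeff≡ nonedge = +-cancelˡ (c edge) _ _ (trans eqJ′ (cong (_+ c′ nonedge) (sym at-edge)))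

  bilinear-ext : ∀ {L L′ : (Relation → ℤ) → (Relation → ℤ) → ℤ} →
    (∀ g → Linear (λ f → L f g)) → (∀ f → Linear (L f)) →
    (∀ g → Linear (λ f → L′ f g)) → (∀ f → Linear (L′ f)) →
    (∀ g → L I g ≡ L′ I g) → (∀ f → L f I ≡ L′ f I) →
    L J J ≡ L′ J J → L J s ≡ L′ J s → L s J ≡ L′ s J → L s s ≡ L′ s s →
    ∀ f g → L f g ≡ L′ f g
  bilinear-ext ℓ₁ ℓ₂ ℓ₁′ ℓ₂′ eqI· eq·I eqJJ eqJs eqsJ eqss f g =
    linear-ext (ℓ₁ g) (ℓ₁′ g) (eqI· g)
      (linear-ext (ℓ₂ J) (ℓ₂′ J) (eq·I J) eqJJ eqJs g)
      (linear-ext (ℓ₂ s) (ℓ₂′ s) (eq·I s) eqsJ eqss g) f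

∑-I : ∀ {n} (G : Graph n) x (F : Fin n → ℤ) → ∑ (allFin n) (λ z → I (rel G x z) * F z) ≡ F x
∑-I {n} G x F = trans
  (∑-cong (allFin n) (λ z → *-congʳ (⟦⟧-cong (same ≟ʳ rel G x z) (x Fin.≟ z)
    (λ eq → rel≡same⇒≡ G (sym eq)) (λ { refl → sym (rel-same G x) }))))
  (∑-δ Fin._≟_ (Unique.allFin⁺ n) (∈-allFin x) F)

-- quadruple may fail when x ≡ y, where pair already gives the sum.  That its
-- value ignores whether x and y are adjacent is more than the 4-vertex condition
-- needs, but holds in both families below.
record Certificate {n} (G : Graph n) : Set where
  field
    s         : Relation → ℤ
    separates : s edge ≢ s nonedge
    moment₁   : ℤ
    row       : ∀ x → ∑ (allFin n) (λ z → s (rel G x z)) ≡ moment₁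
    moment₂   : Relation → ℤ
    pair      : ∀ x y → ∑ (allFin n) (λ z → s (rel G x z) * s (rel G y z)) ≡ moment₂ (rel G x y)
    moment₃   : ℤ
    quadruple : ∀ x y → x ≢ y →
                ∑ (allFin n) (λ z → ∑ (allFin n) (λ w →
                  s (rel G x z) * s (rel G y z) * (s (rel G x w) * s (rel G y w)) * s (rel G z w))) ≡ moment₃

module Agreement {n} {G : Graph n} (cert : Certificate G) where
  open Certificate cert
  open Basis s separates

  private
    V = allFin n
    ρ = rel G

  ∑-rel : (Relation → ℤ) → Fin n → ℤ
  ∑-rel f x = ∑ V (λ z → f (ρ x z))

  ∑-rel-const : ∀ x x′ f → ∑-rel f x ≡ ∑-rel f x′
  ∑-rel-const x x′ = linear-ext (lin x) (lin x′) (trans (count x) (sym (count x′))) refl (trans (row x) (sym (row x′)))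
    where
    lin : ∀ x → Linear (λ f → ∑-rel f x)
    lin x = linear-∑ V (λ z → linear-eval (ρ x z))
    count : ∀ x → ∑-rel I x ≡ 1ℤ
    count x = trans (∑-cong V (λ z → sym (*-identityʳ _))) (∑-I G x (λ _ → 1ℤ))

  W₂ : (Relation → ℤ) → (Relation → ℤ) → Fin n → Fin n → ℤ
  W₂ f g x y = ∑ V (λ z → f (ρ x z) * g (ρ y z))

  W₂-comm : ∀ f g x y → W₂ f g x y ≡ W₂ g f y x
  W₂-comm f g x y = ∑-cong V (λ z → *-comm _ _)

  -- The five weights sit on the pairs xz, yz, xw, yw and zw: every pair among the four vertices
  -- except the prescribed xy.
  W₅ : (f₁ f₂ f₃ f₄ f₅ : Relation → ℤ) → Fin n → Fin n → ℤ
  W₅ f₁ f₂ f₃ f₄ f₅ x y =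
    ∑ V (λ z → ∑ V (λ w → f₁ (ρ x z) * f₂ (ρ y z) * (f₃ (ρ x w) * f₄ (ρ y w)) * f₅ (ρ z w)))

  W₅-swap : ∀ f₁ f₂ f₃ f₄ f₅ x y → W₅ f₁ f₂ f₃ f₄ f₅ x y ≡ W₅ f₃ f₄ f₁ f₂ f₅ x y
  W₅-swap f₁ f₂ f₃ f₄ f₅ x y = trans (∑-swap V V _)
    (∑-cong V (λ z → ∑-cong V (λ w → cong₂ _*_ (*-comm _ _) (cong f₅ (rel-sym G w z)))))

  module _ {x y x′ y′} (same-rel : ρ x y ≡ ρ x′ y′) where

    same-rel′ : ρ y x ≡ ρ y′ x′
    same-rel′ = trans (rel-sym G y x) (trans same-rel (rel-sym G x′ y′))

    -- A factor `I` leaves one term, a factor `J` leaves a row sum, and the case of `s` twice is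
    -- `pair`. The case `x ≡ y` is included and later yields the degrees.
    agree₂ : ∀ f g → W₂ f g x y ≡ W₂ f g x′ y′
    agree₂ = bilinear-ext (λ g → lin₁ x y g) (λ f → lin₂ x y f) (λ g → lin₁ x′ y′ g) (λ f → lin₂ x′ y′ f)
      (λ g → trans (I· g x y) (trans (cong g same-rel′) (sym (I· g x′ y′))))
      (λ f → trans (·I f x y) (trans (cong f same-rel) (sym (·I f x′ y′))))
      refl
      (trans (J· s x y) (trans (∑-rel-const y y′ s) (sym (J· s x′ y′))))
      (trans (·J s x y) (trans (∑-rel-const x x′ s) (sym (·J s x′ y′))))
      (trans (pair x y) (trans (cong moment₂ same-rel) (sym (pair x′ y′))))
      where
      lin₁ : ∀ x y g → Linear (λ f → W₂ f g x y)
      lin₁ x y g = linear-∑ V (λ z → linear-*ʳ _ (linear-eval (ρ x z)))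
      lin₂ : ∀ x y f → Linear (λ g → W₂ f g x y)
      lin₂ x y f = linear-∑ V (λ z → linear-*ˡ _ (linear-eval (ρ y z)))
      I· : ∀ g x y → W₂ I g x y ≡ g (ρ y x)
      I· g x y = ∑-I G x (λ z → g (ρ y z))
      ·I : ∀ f x y → W₂ f I x y ≡ f (ρ x y)
      ·I f x y = trans (W₂-comm f I x y) (I· f y x)
      J· : ∀ g x y → W₂ J g x y ≡ ∑-rel g y
      J· g x y = ∑-cong V (λ z → *-identityˡ _)
      ·J : ∀ f x y → W₂ f J x y ≡ ∑-rel f x
      ·J f x y = ∑-cong V (λ z → *-identityʳ _)

    agree₂′ : ∀ (F : Relation → Relation → ℤ) → ∑ V (λ z → F (ρ x z) (ρ y z)) ≡ ∑ V (λ z → F (ρ x′ z) (ρ y′ z))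
    agree₂′ F = begin
      ∑ V (λ z → F (ρ x z) (ρ y z))               ≡⟨ ∑-cong V (λ z → *-identityˡ _) ⟨
      ∑ V (λ z → 1ℤ * F′ (ρ x z ∷ ρ y z ∷ []))     ≡⟨ ∑-multilinear V (ρ x ∷ ρ y ∷ []) (ρ x′ ∷ ρ y′ ∷ []) _ _ products F′ ⟩
      ∑ V (λ z → 1ℤ * F′ (ρ x′ z ∷ ρ y′ z ∷ []))   ≡⟨ ∑-cong V (λ z → *-identityˡ _) ⟩
      ∑ V (λ z → F (ρ x′ z) (ρ y′ z))             ∎
      where
      F′ : Vec Relation 2 → ℤ
      F′ (r₁ ∷ r₂ ∷ []) = F r₁ r₂
      clean : ∀ a b → 1ℤ * (a * (b * 1ℤ)) ≡ a * b
      clean a b = trans (*-identityˡ _) (*-congˡ (*-identityʳ b))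
      products : ∀ fs → ∑ V (λ z → 1ℤ * ∏ fs (ρ x z ∷ ρ y z ∷ [])) ≡ ∑ V (λ z → 1ℤ * ∏ fs (ρ x′ z ∷ ρ y′ z ∷ []))
      products (f ∷ g ∷ []) = trans (∑-cong V (λ z → clean _ _)) (trans (agree₂ f g) (∑-cong V (λ z → sym (clean _ _))))

    -- The sum over `z` is a function of the relations of `w` to `x` and `y`, one and the same
    -- function for both pairs, so the sum over `w` falls to `agree₂′`. This is established below
    -- when `f₁` or `f₂` is `I` or `J`: an `I` pins `z` to `x` or `y`, and a `J` leaves a row sum or
    -- the sum over a single pair. The case of `s` twice is the one left to `quadruple`.
    Collapses : (f₁ f₂ : Relation → ℤ) → Set
    Collapses f₁ f₂ = Σ (Relation → Relation → ℤ) λ C →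
      (∀ w → ∑ V (λ z → f₁ (ρ x z) * f₂ (ρ y z) * s (ρ z w)) ≡ C (ρ x w) (ρ y w)) ×
      (∀ w → ∑ V (λ z → f₁ (ρ x′ z) * f₂ (ρ y′ z) * s (ρ z w)) ≡ C (ρ x′ w) (ρ y′ w))

    collapses-I· : ∀ f → Collapses I f
    collapses-I· f = (λ u _ → f (ρ y x) * s u) , collapse x y ,
      λ w → trans (collapse x′ y′ w) (cong (λ r → f r * s (ρ x′ w)) (sym same-rel′))
      where
      collapse : ∀ x y w → ∑ V (λ z → I (ρ x z) * f (ρ y z) * s (ρ z w)) ≡ f (ρ y x) * s (ρ x w)
      collapse x y w = trans (∑-cong V (λ z → *-assoc _ _ _)) (∑-I G x (λ z → f (ρ y z) * s (ρ z w)))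

    collapses-·I : ∀ f → Collapses f I
    collapses-·I f = (λ _ v → f (ρ x y) * s v) , collapse x y , λ w → trans (collapse x′ y′ w) (*-congʳ (cong f (sym same-rel)))
      where
      collapse : ∀ x y w → ∑ V (λ z → f (ρ x z) * I (ρ y z) * s (ρ z w)) ≡ f (ρ x y) * s (ρ y w)
      collapse x y w = trans (∑-cong V (λ z → trans (*-congʳ (*-comm _ _)) (*-assoc _ _ _)))
          (∑-I G y (λ z → f (ρ x z) * s (ρ z w)))

    collapses-JJ : Collapses J J
    collapses-JJ = (λ _ _ → moment₁) , collapse , collapse
      where
      collapse : ∀ w → ∑ V (λ z → 1ℤ * 1ℤ * s (ρ z w)) ≡ moment₁
      collapse w = trans (∑-cong V (λ z → trans (*-congʳ (*-identityˡ 1ℤ))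
          (trans (*-identityˡ _) (cong s (rel-sym G z w))))) (row w)

    collapses-Js : Collapses J s
    collapses-Js = (λ _ v → moment₂ v) , collapse y , collapse y′
      where
      collapse : ∀ y w → ∑ V (λ z → 1ℤ * s (ρ y z) * s (ρ z w)) ≡ moment₂ (ρ y w)
      collapse y w = trans (∑-cong V (λ z → cong₂ _*_ (*-identityˡ _) (cong s (rel-sym G z w)))) (pair y w)

    collapses-sJ : Collapses s J
    collapses-sJ = (λ u _ → moment₂ u) , collapse x , collapse x′
      where
      collapse : ∀ x w → ∑ V (λ z → s (ρ x z) * 1ℤ * s (ρ z w)) ≡ moment₂ (ρ x w)
      collapse x w = trans (∑-cong V (λ z → cong₂ _*_ (*-identityʳ _) (cong s (rel-sym G z w)))) (pair x w)

    collapse-agree : ∀ f₁ f₂ f₃ f₄ → Collapses f₁ f₂ → W₅ f₁ f₂ f₃ f₄ s x y ≡ W₅ f₁ f₂ f₃ f₄ s x′ y′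
    collapse-agree f₁ f₂ f₃ f₄ (C , eq , eq′) =
      trans (collapse x y eq) (trans (agree₂′ (λ u v → f₃ u * f₄ v * C u v)) (sym (collapse x′ y′ eq′)))
      where
      reorder : ∀ a b c → a * b * c ≡ b * (a * c)
      reorder a b c = trans (*-congʳ (*-comm a b)) (*-assoc b a c)
      collapse : ∀ x y → (∀ w → ∑ V (λ z → f₁ (ρ x z) * f₂ (ρ y z) * s (ρ z w)) ≡ C (ρ x w) (ρ y w)) →
                 W₅ f₁ f₂ f₃ f₄ s x y ≡ ∑ V (λ w → f₃ (ρ x w) * f₄ (ρ y w) * C (ρ x w) (ρ y w))
      collapse x y eq = trans (∑-swap V V _) (∑-cong V (λ w →
        trans (∑-cong V (λ z → reorder _ _ _)) (trans (∑-*ˡ V _ _) (*-congˡ (eq w)))))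

    module _ (x≢y : x ≢ y) (x′≢y′ : x′ ≢ y′) where

      -- The weights at `z` are reduced to `s` and `s` first, then those at `w`, by exchanging the
      -- roles of `z` and `w`; every exceptional case on the way collapses.
      agree-s : ∀ f₁ f₂ f₃ f₄ → W₅ f₁ f₂ f₃ f₄ s x y ≡ W₅ f₁ f₂ f₃ f₄ s x′ y′
      agree-s f₁ f₂ f₃ f₄ = bilinear-ext (lin₁ x y) (lin₂ x y) (lin₁ x′ y′) (lin₂ x′ y′)
        (λ g → left I g (collapses-I· g)) (λ f → left f I (collapses-·I f)) (left J J collapses-JJ) (left J s collapses-Js)
            (left s J collapses-sJ)
        (bilinear-ext (lin₃ x y) (lin₄ x y) (lin₃ x′ y′) (lin₄ x′ y′)
          (λ g → right I g (collapses-I· g)) (λ f → right f I (collapses-·I f)) (right J J collapses-JJ)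
              (right J s collapses-Js) (right s J collapses-sJ)
          (trans (quadruple x y x≢y) (sym (quadruple x′ y′ x′≢y′)))
          f₃ f₄)
        f₁ f₂
        where
        left : ∀ f₁ f₂ → Collapses f₁ f₂ → W₅ f₁ f₂ f₃ f₄ s x y ≡ W₅ f₁ f₂ f₃ f₄ s x′ y′
        left f₁ f₂ = collapse-agree f₁ f₂ f₃ f₄
        right : ∀ f₃ f₄ → Collapses f₃ f₄ → W₅ s s f₃ f₄ s x y ≡ W₅ s s f₃ f₄ s x′ y′
        right f₃ f₄ c = trans (W₅-swap s s f₃ f₄ s x y) (trans (collapse-agree f₃ f₄ s s c) (sym (W₅-swap s s f₃ f₄ s x′ y′)))
        lin₁ : ∀ x y g → Linear (λ f → W₅ f g f₃ f₄ s x y)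
        lin₁ x y g = linear-∑ V (λ z → linear-∑ V (λ w → linear-*ʳ _ (linear-*ʳ _ (linear-*ʳ _ (linear-eval (ρ x z))))))
        lin₂ : ∀ x y f → Linear (λ g → W₅ f g f₃ f₄ s x y)
        lin₂ x y f = linear-∑ V (λ z → linear-∑ V (λ w → linear-*ʳ _ (linear-*ʳ _ (linear-*ˡ _ (linear-eval (ρ y z))))))
        lin₃ : ∀ x y g → Linear (λ f → W₅ s s f g s x y)
        lin₃ x y g = linear-∑ V (λ z → linear-∑ V (λ w → linear-*ʳ _ (linear-*ˡ _ (linear-*ʳ _ (linear-eval (ρ x w))))))
        lin₄ : ∀ x y f → Linear (λ g → W₅ s s f g s x y)
        lin₄ x y f = linear-∑ V (λ z → linear-∑ V (λ w → linear-*ʳ _ (linear-*ˡ _ (linear-*ˡ _ (linear-eval (ρ y w))))))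

      -- The last weight is treated as the others were: `I` identifies `w` with `z`, `J` uncouples
      -- the two sums into a product, and `s` is the preceding lemma.
      agree₅ : ∀ f₁ f₂ f₃ f₄ f₅ → W₅ f₁ f₂ f₃ f₄ f₅ x y ≡ W₅ f₁ f₂ f₃ f₄ f₅ x′ y′
      agree₅ f₁ f₂ f₃ f₄ = linear-ext (lin x y) (lin x′ y′)
        (trans (diagonal x y) (trans (agree₂′ (λ u v → f₁ u * f₂ v * (f₃ u * f₄ v))) (sym (diagonal x′ y′))))
        (trans (splits x y) (trans (cong₂ _*_ (agree₂ f₁ f₂) (agree₂ f₃ f₄)) (sym (splits x′ y′))))
        (agree-s f₁ f₂ f₃ f₄)
        where
        lin : ∀ x y → Linear (λ f → W₅ f₁ f₂ f₃ f₄ f x y)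
        lin x y = linear-∑ V (λ z → linear-∑ V (λ w → linear-*ˡ _ (linear-eval (ρ z w))))
        diagonal : ∀ x y → W₅ f₁ f₂ f₃ f₄ I x y ≡ ∑ V (λ z → f₁ (ρ x z) * f₂ (ρ y z) * (f₃ (ρ x z) * f₄ (ρ y z)))
        diagonal x y = ∑-cong V (λ z → trans (∑-cong V (λ w → *-comm _ _))
          (∑-I G z (λ w → f₁ (ρ x z) * f₂ (ρ y z) * (f₃ (ρ x w) * f₄ (ρ y w)))))
        splits : ∀ x y → W₅ f₁ f₂ f₃ f₄ J x y ≡ W₂ f₁ f₂ x y * W₂ f₃ f₄ x y
        splits x y = trans (∑-cong V (λ z → ∑-cong V (λ w → *-identityʳ _)))
          (∑-product V V (λ z → f₁ (ρ x z) * f₂ (ρ y z)) (λ w → f₃ (ρ x w) * f₄ (ρ y w)))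

      agree₅′ : ∀ (F : Relation → Relation → Relation → Relation → Relation → ℤ) →
        ∑ V (λ z → ∑ V (λ w → F (ρ x z) (ρ y z) (ρ x w) (ρ y w) (ρ z w))) ≡
        ∑ V (λ z → ∑ V (λ w → F (ρ x′ z) (ρ y′ z) (ρ x′ w) (ρ y′ w) (ρ z w)))
      agree₅′ F = trans (as-pairs x y) (trans
        (∑-multilinear (cartesianProduct V V) (rs x y) (rs x′ y′) _ _ products F′) (sym (as-pairs x′ y′)))
        where
        F′ : Vec Relation 5 → ℤ
        F′ (r₁ ∷ r₂ ∷ r₃ ∷ r₄ ∷ r₅ ∷ []) = F r₁ r₂ r₃ r₄ r₅
        rs : Fin n → Fin n → Vec (Fin n × Fin n → Relation) 5
        rs x y = (λ zw → ρ x (proj₁ zw)) ∷ (λ zw → ρ y (proj₁ zw)) ∷ (λ zw → ρ x (proj₂ zw)) ∷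
                 (λ zw → ρ y (proj₂ zw)) ∷ (λ zw → ρ (proj₁ zw) (proj₂ zw)) ∷ []
        as-pairs : ∀ x y → ∑ V (λ z → ∑ V (λ w → F (ρ x z) (ρ y z) (ρ x w) (ρ y w) (ρ z w))) ≡
                   ∑ (cartesianProduct V V) (λ i → 1ℤ * F′ (rs x y at i))
        as-pairs x y = trans (∑-cong V (λ z → ∑-cong V (λ w → sym (*-identityˡ _)))) (sym (∑-cartesianProduct V V _))
        clean : ∀ a b c d e → 1ℤ * (a * (b * (c * (d * (e * 1ℤ))))) ≡ a * b * (c * d) * e
        clean a b c d e = begin
          1ℤ * (a * (b * (c * (d * (e * 1ℤ)))))  ≡⟨ *-identityˡ _ ⟩
          a * (b * (c * (d * (e * 1ℤ))))         ≡⟨ cong (λ e′ → a * (b * (c * (d * e′)))) (*-identityʳ e) ⟩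
          a * (b * (c * (d * e)))                ≡⟨ *-assoc a b _ ⟨
          a * b * (c * (d * e))                  ≡⟨ *-congˡ (*-assoc c d e) ⟨
          a * b * (c * d * e)                    ≡⟨ *-assoc (a * b) (c * d) e ⟨
          a * b * (c * d) * e                    ∎
        products : ∀ fs → ∑ (cartesianProduct V V) (λ i → 1ℤ * ∏ fs (rs x y at i)) ≡
                          ∑ (cartesianProduct V V) (λ i → 1ℤ * ∏ fs (rs x′ y′ at i))
        products (f₁ ∷ f₂ ∷ f₃ ∷ f₄ ∷ f₅ ∷ []) = trans (as-W₅ x y) (trans (agree₅ f₁ f₂ f₃ f₄ f₅) (sym (as-W₅ x′ y′)))
          where
          as-W₅ : ∀ x y → ∑ (cartesianProduct V V) (λ i → 1ℤ * ∏ (f₁ ∷ f₂ ∷ f₃ ∷ f₄ ∷ f₅ ∷ [])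
              (rs x y at i)) ≡ W₅ f₁ f₂ f₃ f₄ f₅ x y
          as-W₅ x y = trans (∑-cartesianProduct V V _) (∑-cong V (λ z → ∑-cong V (λ w → clean _ _ _ _ _)))

-- Counting copies through ordered pairs of further vertices

⟦⟧-⊎ : {P Q R : Set} (p? : Dec P) (q? : Dec Q) (r? : Dec R) →
       ¬ (P × Q) → (R → P ⊎ Q) → (P → R) → (Q → R) → ⟦ r? ⟧ ≡ ⟦ p? ⟧ + ⟦ q? ⟧
⟦⟧-⊎ (yes p) (yes q) r? ¬pq _ _ _  = contradiction (p , q) ¬pq
⟦⟧-⊎ (yes p) (no _)  r? _ _ from _ = trans (⟦⟧-true r? (from p)) (sym (+-identityʳ _))
⟦⟧-⊎ (no _)  (yes q) r? _ _ _ from = trans (⟦⟧-true r? (from q)) (sym (+-identityˡ _))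
⟦⟧-⊎ (no ¬p) (no ¬q) r? _ to _ _   = trans (⟦⟧-false r? (λ r → Sum.[ ¬p , ¬q ] (to r))) (sym (+-identityʳ _))

image : ∀ {m n} → Vec (Fin n) m → Subset n
image []      = ⊥
image (u ∷ v) = ⁅ u ⁆ ∪ image v

∈-image⁺ : ∀ {m n} (v : Vec (Fin n) m) i → Vec.lookup v i Subset.∈ image v
∈-image⁺ (u ∷ v) zero    = Subset.p⊆p∪q (image v) (Subset.x∈⁅x⁆ u)
∈-image⁺ (u ∷ v) (suc i) = Subset.q⊆p∪q ⁅ u ⁆ (image v) (∈-image⁺ v i)

∈-image⁻ : ∀ {m n} (v : Vec (Fin n) m) {u} → u Subset.∈ image v → ∃ λ i → Vec.lookup v i ≡ u
∈-image⁻ []      u∈ = contradiction u∈ Subset.∉⊥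
∈-image⁻ (u ∷ v) u∈ with Subset.x∈p∪q⁻ ⁅ u ⁆ (image v) u∈
... | inj₁ u∈ˡ = zero , sym (Subset.x∈⁅y⁆⇒x≡y u u∈ˡ)
... | inj₂ u∈ʳ with i , eq ← ∈-image⁻ v u∈ʳ = suc i , eq

cone : ∀ {m} → Vec Bool m → Graph m → Graph (suc m)
cone {m} bs H = record { adj = adj′ ; sym = sym′ ; irrefl = irrefl′ }
  where
  adj′ : Fin (suc m) → Fin (suc m) → Bool
  adj′ zero    zero    = false
  adj′ zero    (suc j) = Vec.lookup bs j
  adj′ (suc i) zero    = Vec.lookup bs i
  adj′ (suc i) (suc j) = adj H i j
  sym′ : ∀ i j → adj′ i j ≡ adj′ j i
  sym′ zero    zero    = refl
  sym′ zero    (suc j) = refl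
  sym′ (suc i) zero    = refl
  sym′ (suc i) (suc j) = Graph.sym H i j
  irrefl′ : ∀ i → adj′ i i ≡ false
  irrefl′ zero    = refl
  irrefl′ (suc i) = Graph.irrefl H i

empty : Graph 0
empty = record { adj = λ () ; sym = λ () ; irrefl = λ () }

Injective : ∀ {m n} → Vec (Fin n) m → Set
Injective v = ∀ i j → Vec.lookup v i ≡ Vec.lookup v j → i ≡ j

injective-[] : ∀ {n} → Injective {n = n} []
injective-[] ()

injective-∷ : ∀ {m n u} {v : Vec (Fin n) m} → (∀ j → u ≢ Vec.lookup v j) → Injective v → Injective (u ∷ v)
injective-∷ u∉ inj zero    zero    _  = refl
injective-∷ u∉ inj zero    (suc j) eq = contradiction eq (u∉ j)
injective-∷ u∉ inj (suc i) zero    eq = contradiction (sym eq) (u∉ i)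
injective-∷ u∉ inj (suc i) (suc j) eq = cong suc (inj i j eq)

module _ {n} (G : Graph n) where

  Induced : ∀ {m} → Graph m → Vec (Fin n) m → Set
  Induced H v = ∀ i j → adj H i j ≡ adj G (Vec.lookup v i) (Vec.lookup v j)

  induced-cone : ∀ {m u} {v : Vec (Fin n) m} {H bs} → (∀ j → Vec.lookup bs j ≡ adj G u (Vec.lookup v j)) →
                 Induced H v → Induced (cone bs H) (u ∷ v)
  induced-cone {u = u} eq ind zero    zero    = sym (Graph.irrefl G u)
  induced-cone         eq ind zero    (suc j) = eq j
  induced-cone         eq ind (suc i) zero    = trans (eq i) (Graph.sym G _ _)
  induced-cone         eq ind (suc i) (suc j) = ind i j

  module _ {t m} (T : Graph t) (x₀ y₀ : Fin t) (H : Graph m) (v : Vec (Fin n) m)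
           (inj : Injective v) (ind : Induced H v) (p q : Fin m) where

    private
      a : Fin m → Fin n
      a = Vec.lookup v

    copy-push : IsCopy T x₀ y₀ H p q ⊤ → IsCopy T x₀ y₀ G (a p) (a q) (image v)
    copy-push (φ , _ , onto , φ-inj , φ-adj , φx₀ , φy₀) =
      Vec.map a φ ,
      (λ i → subst (Subset._∈ image v) (sym (at i)) (∈-image⁺ v (Vec.lookup φ i))) ,
      (λ u u∈ → let k , ak≡u = ∈-image⁻ v u∈ ; i , φi≡k = onto k Subset.∈⊤ in i , trans (at i) (trans (cong a φi≡k) ak≡u)) ,
      (λ i j eq → φ-inj i j (inj _ _ (trans (sym (at i)) (trans eq (at j))))) ,
      (λ i j → trans (φ-adj i j) (trans (ind _ _) (sym (cong₂ (adj G) (at i) (at j))))) ,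
      trans (at x₀) (cong a φx₀) ,
      trans (at y₀) (cong a φy₀)
      where
      at : ∀ i → Vec.lookup (Vec.map a φ) i ≡ a (Vec.lookup φ i)
      at i = Vec.lookup-map i a φ

    copy-pull : IsCopy T x₀ y₀ G (a p) (a q) (image v) → IsCopy T x₀ y₀ H p q ⊤
    copy-pull (φ , into , onto , φ-inj , φ-adj , φx₀ , φy₀) =
      Vec.tabulate k ,
      (λ i → Subset.∈⊤) ,
      (λ u _ → let i , eq = onto (a u) (∈-image⁺ v u) in i , trans (at i) (inj _ _ (trans (ak i) eq))) ,
      (λ i j eq → φ-inj i j (trans (sym (ak i)) (trans (cong a (trans (sym (at i)) (trans eq (at j)))) (ak j)))) ,
      (λ i j → trans (φ-adj i j) (trans (sym (cong₂ (adj G) (ak i) (ak j)))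
                 (trans (sym (ind _ _)) (sym (cong₂ (adj H) (at i) (at j)))))) ,
      trans (at x₀) (inj _ _ (trans (ak x₀) φx₀)) ,
      trans (at y₀) (inj _ _ (trans (ak y₀) φy₀))
      where
      k : Fin t → Fin m
      k i = proj₁ (∈-image⁻ v (into i))
      ak : ∀ i → a (k i) ≡ Vec.lookup φ i
      ak i = proj₂ (∈-image⁻ v (into i))
      at : ∀ i → Vec.lookup (Vec.tabulate k) i ≡ k i
      at = Vec.lookup∘tabulate k

Remaining : Fin 4 → Fin 4 → Fin 4 → Fin 4 → Set
Remaining x₀ y₀ i j = i ≢ j × i ≢ x₀ × i ≢ y₀ × j ≢ x₀ × j ≢ y₀ × (∀ k → k ≡ x₀ ⊎ k ≡ y₀ ⊎ k ≡ i ⊎ k ≡ j)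

remaining? : ∀ x₀ y₀ i j → Dec (Remaining x₀ y₀ i j)
remaining? x₀ y₀ i j =
  ¬? (i Fin.≟ j) ×-dec ¬? (i Fin.≟ x₀) ×-dec ¬? (i Fin.≟ y₀) ×-dec ¬? (j Fin.≟ x₀) ×-dec ¬? (j Fin.≟ y₀) ×-dec
  Fin.all? (λ k → (k Fin.≟ x₀) ⊎-dec (k Fin.≟ y₀) ⊎-dec (k Fin.≟ i) ⊎-dec (k Fin.≟ j))

remaining : ∀ x₀ y₀ → x₀ ≢ y₀ → ∃ λ i → ∃ λ j → Remaining x₀ y₀ i j
remaining = toWitness {a? = Fin.all? λ x₀ → Fin.all? λ y₀ → ¬? (x₀ Fin.≟ y₀) →-dec Fin.any? λ i → Fin.any? λ j →
    remaining? x₀ y₀ i j} _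

module _ (T : Graph 4) (x₀ y₀ : Fin 4) where

  quad : (xy xz yz xw yw zw : Relation) → Graph 4
  quad xy xz yz xw yw zw =
    cone (Vec.map isEdge (xy ∷ xz ∷ xw ∷ [])) (cone (Vec.map isEdge (yz ∷ yw ∷ []))
        (cone (Vec.map isEdge (zw ∷ [])) (cone [] empty)))

  -- Since `isEdge` cannot tell coincidence from nonadjacency, the distinctness of the vertices is
  -- recorded apart. In this form the property depends on the six relations alone, which is what
  -- lets `agree₅′` apply.
  Fits : (xy xz yz xw yw zw : Relation) → Set
  Fits xy xz yz xw yw zw =
    (xz ≢ same × yz ≢ same × xw ≢ same × yw ≢ same × zw ≢ same) ×
    IsCopy T x₀ y₀ (quad xy xz yz xw yw zw) 0F 1F ⊤

  fits? : ∀ xy xz yz xw yw zw → Dec (Fits xy xz yz xw yw zw)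
  fits? xy xz yz xw yw zw =
    (¬? (xz ≟ʳ same) ×-dec ¬? (yz ≟ʳ same) ×-dec ¬? (xw ≟ʳ same) ×-dec ¬? (yw ≟ʳ same) ×-dec ¬? (zw ≟ʳ same)) ×-dec
    isCopy? T x₀ y₀ (quad xy xz yz xw yw zw) 0F 1F ⊤

module _ (T : Graph 4) (x₀ y₀ : Fin 4) (x₀≢y₀ : x₀ ≢ y₀) {n} (G : Graph n) (x y : Fin n) (x≢y : x ≢ y) where

  private
    V = allFin n
    ρ = rel G

    span : Fin n → Fin n → Subset n
    span z w = image (x ∷ y ∷ z ∷ w ∷ [])

    Distinct : Fin n → Fin n → Set
    Distinct z w = x ≢ z × y ≢ z × x ≢ w × y ≢ w × z ≢ w

    distinct? : ∀ z w → Dec (Distinct z w)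
    distinct? z w = ¬? (x Fin.≟ z) ×-dec ¬? (y Fin.≟ z) ×-dec ¬? (x Fin.≟ w) ×-dec ¬? (y Fin.≟ w) ×-dec ¬? (z Fin.≟ w)

    injective-span : ∀ {z w} → Distinct z w → Injective (x ∷ y ∷ z ∷ w ∷ [])
    injective-span (x≢z , y≢z , x≢w , y≢w , z≢w) =
      injective-∷ (λ { 0F → x≢y ; 1F → x≢z ; 2F → x≢w })
        (injective-∷ (λ { 0F → y≢z ; 1F → y≢w }) (injective-∷ (λ { 0F → z≢w }) (injective-∷ (λ ()) injective-[])))

    induced-span : ∀ z w → Induced G (quad T x₀ y₀ (ρ x y) (ρ x z) (ρ y z) (ρ x w) (ρ y w) (ρ z w)) (x ∷ y ∷ z ∷ w ∷ [])
    induced-span z w =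
      induced-cone G {v = y ∷ z ∷ w ∷ []} (λ { 0F → edge≡ x y ; 1F → edge≡ x z ; 2F → edge≡ x w })
        (induced-cone G {v = z ∷ w ∷ []} (λ { 0F → edge≡ y z ; 1F → edge≡ y w })
          (induced-cone G {v = w ∷ []} (λ { 0F → edge≡ z w }) (induced-cone G {v = []} (λ ()) (λ ()))))
      where
      edge≡ : ∀ u v → isEdge (ρ u v) ≡ adj G u v
      edge≡ u v = sym (adj≡isEdge G u v)

    -- The two pairs are `(p , q)` and `(q , p)`, where `p` and `q` are the images of the two
    -- vertices of `T` other than `x₀` and `y₀`.
    pair-count : ∀ {S} → IsCopy T x₀ y₀ G x y S →
                 ∑ V (λ z → ∑ V (λ w → ⟦ distinct? z w ⟧ * ⟦ span z w ≟ᵛ S ⟧)) ≡ 1ℤ + 1ℤ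
    pair-count {S} (φ , into , onto , φ-inj , φ-adj , φx₀ , φy₀)
      with i , j , i≢j , i≢x₀ , i≢y₀ , j≢x₀ , j≢y₀ , exhaust ← remaining x₀ y₀ x₀≢y₀ = begin
        ∑ V (λ z → ∑ V (λ w → ⟦ distinct? z w ⟧ * ⟦ span z w ≟ᵛ S ⟧))
          ≡⟨ ∑-cong V (λ z → trans (∑-cong V (two z)) (∑-+ V _ _)) ⟩
        ∑ V (λ z → ∑ V (λ w → ⟦ p Fin.≟ z ⟧ * ⟦ q Fin.≟ w ⟧) + ∑ V (λ w → ⟦ q Fin.≟ z ⟧ * ⟦ p Fin.≟ w ⟧))
          ≡⟨ ∑-+ V _ _ ⟩
        ∑ V (λ z → ∑ V (λ w → ⟦ p Fin.≟ z ⟧ * ⟦ q Fin.≟ w ⟧)) + ∑ V (λ z → ∑ V (λ w → ⟦ q Fin.≟ z ⟧ * ⟦ p Fin.≟ w ⟧))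
          ≡⟨ cong₂ _+_ (one p q) (one q p) ⟩
        1ℤ + 1ℤ ∎
      where
      p q : Fin n
      p = Vec.lookup φ i
      q = Vec.lookup φ j

      total : ∀ u → ∑ V (λ z → ⟦ u Fin.≟ z ⟧) ≡ 1ℤ
      total u = trans (∑-cong V (λ z → sym (*-identityʳ _))) (∑-δ Fin._≟_ (Unique.allFin⁺ n) (∈-allFin u) (λ _ → 1ℤ))

      one : ∀ u u′ → ∑ V (λ z → ∑ V (λ w → ⟦ u Fin.≟ z ⟧ * ⟦ u′ Fin.≟ w ⟧)) ≡ 1ℤ
      one u u′ = trans (∑-product V V _ _) (trans (cong₂ _*_ (total u) (total u′)) (*-identityʳ 1ℤ))

      is-p-or-q : ∀ {u} → u Subset.∈ S → x ≢ u → y ≢ u → p ≡ u ⊎ q ≡ u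
      is-p-or-q {u} u∈ x≢u y≢u with onto u u∈
      ... | k , φk≡u with exhaust k
      ...   | inj₁ refl                 = contradiction (trans (sym φx₀) φk≡u) x≢u
      ...   | inj₂ (inj₁ refl)          = contradiction (trans (sym φy₀) φk≡u) y≢u
      ...   | inj₂ (inj₂ (inj₁ refl))   = inj₁ φk≡u
      ...   | inj₂ (inj₂ (inj₂ refl))   = inj₂ φk≡u

      x∈S : x Subset.∈ S
      x∈S = subst (Subset._∈ S) φx₀ (into x₀)
      y∈S : y Subset.∈ S
      y∈S = subst (Subset._∈ S) φy₀ (into y₀)

      p≢q : p ≢ q
      p≢q p≡q = i≢j (φ-inj i j p≡q)

      x≢φ : ∀ {k} → k ≢ x₀ → x ≢ Vec.lookup φ k
      x≢φ k≢x₀ eq = k≢x₀ (φ-inj _ _ (trans (sym eq) (sym φx₀)))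
      y≢φ : ∀ {k} → k ≢ y₀ → y ≢ Vec.lookup φ k
      y≢φ k≢y₀ eq = k≢y₀ (φ-inj _ _ (trans (sym eq) (sym φy₀)))

      span≡ : ∀ {z w} → z Subset.∈ S → w Subset.∈ S → (∀ {u} → u Subset.∈ S → u ≡ x ⊎ u ≡ y ⊎ u ≡ z ⊎ u ≡ w) → span z w ≡ S
      span≡ {z} {w} z∈ w∈ cover = Subset.⊆-antisym ⊆ ⊇
        where
        ⊆ : span z w Subset.⊆ S
        ⊆ u∈ with ∈-image⁻ (x ∷ y ∷ z ∷ w ∷ []) u∈
        ... | 0F , refl = x∈S
        ... | 1F , refl = y∈S
        ... | 2F , refl = z∈
        ... | 3F , refl = w∈
        ⊇ : S Subset.⊆ span z w
        ⊇ u∈ with cover u∈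
        ... | inj₁ refl               = ∈-image⁺ (x ∷ y ∷ z ∷ w ∷ []) 0F
        ... | inj₂ (inj₁ refl)        = ∈-image⁺ (x ∷ y ∷ z ∷ w ∷ []) 1F
        ... | inj₂ (inj₂ (inj₁ refl)) = ∈-image⁺ (x ∷ y ∷ z ∷ w ∷ []) 2F
        ... | inj₂ (inj₂ (inj₂ refl)) = ∈-image⁺ (x ∷ y ∷ z ∷ w ∷ []) 3F

      cover : ∀ {u} → u Subset.∈ S → u ≡ x ⊎ u ≡ y ⊎ u ≡ p ⊎ u ≡ q
      cover {u} u∈ with onto u u∈
      ... | k , refl with exhaust k
      ...   | inj₁ refl               = inj₁ φx₀
      ...   | inj₂ (inj₁ refl)        = inj₂ (inj₁ φy₀)
      ...   | inj₂ (inj₂ (inj₁ refl)) = inj₂ (inj₂ (inj₁ refl))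
      ...   | inj₂ (inj₂ (inj₂ refl)) = inj₂ (inj₂ (inj₂ refl))

      cover′ : ∀ {u} → u Subset.∈ S → u ≡ x ⊎ u ≡ y ⊎ u ≡ q ⊎ u ≡ p
      cover′ u∈ with cover u∈
      ... | inj₁ eq               = inj₁ eq
      ... | inj₂ (inj₁ eq)        = inj₂ (inj₁ eq)
      ... | inj₂ (inj₂ (inj₁ eq)) = inj₂ (inj₂ (inj₂ eq))
      ... | inj₂ (inj₂ (inj₂ eq)) = inj₂ (inj₂ (inj₁ eq))

      two : ∀ z w → ⟦ distinct? z w ⟧ * ⟦ span z w ≟ᵛ S ⟧ ≡ ⟦ p Fin.≟ z ⟧ * ⟦ q Fin.≟ w ⟧ + ⟦ q Fin.≟ z ⟧ * ⟦ p Fin.≟ w ⟧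
      two z w = begin
        ⟦ distinct? z w ⟧ * ⟦ span z w ≟ᵛ S ⟧
          ≡⟨ ⟦⟧-* (distinct? z w) (span z w ≟ᵛ S) (distinct? z w ×-dec (span z w ≟ᵛ S)) _,_ proj₁ proj₂ ⟩
        ⟦ distinct? z w ×-dec (span z w ≟ᵛ S) ⟧
          ≡⟨ ⟦⟧-⊎ (p Fin.≟ z ×-dec q Fin.≟ w) (q Fin.≟ z ×-dec p Fin.≟ w) (distinct? z w ×-dec (span z w ≟ᵛ S))
                  (λ { ((p≡z , _) , (q≡z , _)) → p≢q (trans p≡z (sym q≡z)) }) to from from′ ⟩
        ⟦ p Fin.≟ z ×-dec q Fin.≟ w ⟧ + ⟦ q Fin.≟ z ×-dec p Fin.≟ w ⟧
          ≡⟨ cong₂ _+_ (⟦⟧-* (p Fin.≟ z) (q Fin.≟ w) (p Fin.≟ z ×-dec q Fin.≟ w) _,_ proj₁ proj₂)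
              (⟦⟧-* (q Fin.≟ z) (p Fin.≟ w) (q Fin.≟ z ×-dec p Fin.≟ w) _,_ proj₁ proj₂) ⟨
        ⟦ p Fin.≟ z ⟧ * ⟦ q Fin.≟ w ⟧ + ⟦ q Fin.≟ z ⟧ * ⟦ p Fin.≟ w ⟧ ∎
        where
        to : Distinct z w × span z w ≡ S → (p ≡ z × q ≡ w) ⊎ (q ≡ z × p ≡ w)
        to ((x≢z , y≢z , x≢w , y≢w , z≢w) , refl)
          with is-p-or-q (∈-image⁺ (x ∷ y ∷ z ∷ w ∷ []) 2F) x≢z y≢z | is-p-or-q (∈-image⁺ (x ∷ y ∷ z ∷ w ∷ []) 3F) x≢w y≢w
        ... | inj₁ p≡z | inj₁ p≡w = contradiction (trans (sym p≡z) p≡w) z≢w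
        ... | inj₁ p≡z | inj₂ q≡w = inj₁ (p≡z , q≡w)
        ... | inj₂ q≡z | inj₁ p≡w = inj₂ (q≡z , p≡w)
        ... | inj₂ q≡z | inj₂ q≡w = contradiction (trans (sym q≡z) q≡w) z≢w
        from : p ≡ z × q ≡ w → Distinct z w × span z w ≡ S
        from (refl , refl) = (x≢φ i≢x₀ , y≢φ i≢y₀ , x≢φ j≢x₀ , y≢φ j≢y₀ , p≢q) , span≡ (into i) (into j) cover
        from′ : q ≡ z × p ≡ w → Distinct z w × span z w ≡ S
        from′ (refl , refl) = (x≢φ j≢x₀ , y≢φ j≢y₀ , x≢φ i≢x₀ , y≢φ i≢y₀ , ≢-sym p≢q) , span≡ (into j) (into i) cover′

  -- Each copy arises from two ordered pairs (z , w), because the remaining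
  -- two vertices of T can be listed in either order.
  copies-by-pairs : ℤ.+ copies T x₀ y₀ G x y * (1ℤ + 1ℤ) ≡
    ∑ V (λ z → ∑ V (λ w → ⟦ fits? T x₀ y₀ (ρ x y) (ρ x z) (ρ y z) (ρ x w) (ρ y w) (ρ z w) ⟧))
  copies-by-pairs = begin
    ℤ.+ copies T x₀ y₀ G x y * (1ℤ + 1ℤ)
      ≡⟨ *-congʳ (length-filter≡∑ copy? (subsets n)) ⟩
    ∑ (subsets n) (λ S → ⟦ copy? S ⟧) * (1ℤ + 1ℤ)
      ≡⟨ ∑-*ʳ (subsets n) (1ℤ + 1ℤ) _ ⟨
    ∑ (subsets n) (λ S → ⟦ copy? S ⟧ * (1ℤ + 1ℤ))
      ≡⟨ ∑-cong (subsets n) (λ S → ⟦⟧-*-cong (copy? S) pair-count) ⟨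
    ∑ (subsets n) (λ S → ⟦ copy? S ⟧ * ∑ V (λ z → ∑ V (λ w → ⟦ distinct? z w ⟧ * ⟦ span z w ≟ᵛ S ⟧)))
      ≡⟨ ∑-cong (subsets n) (λ S → trans (∑-cong V (λ z → ∑-*ˡ V ⟦ copy? S ⟧ _)) (∑-*ˡ V ⟦ copy? S ⟧ _)) ⟨
    ∑ (subsets n) (λ S → ∑ V (λ z → ∑ V (λ w → ⟦ copy? S ⟧ * (⟦ distinct? z w ⟧ * ⟦ span z w ≟ᵛ S ⟧))))
      ≡⟨ trans (∑-swap (subsets n) V _) (∑-cong V (λ z → ∑-swap (subsets n) V _)) ⟩
    ∑ V (λ z → ∑ V (λ w → ∑ (subsets n) (λ S → ⟦ copy? S ⟧ * (⟦ distinct? z w ⟧ * ⟦ span z w ≟ᵛ S ⟧))))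
      ≡⟨ ∑-cong V (λ z → ∑-cong V (λ w → only z w)) ⟩
    ∑ V (λ z → ∑ V (λ w → ⟦ distinct? z w ⟧ * ⟦ copy? (span z w) ⟧))
      ≡⟨ ∑-cong V (λ z → ∑-cong V (λ w → ⟦⟧-* (distinct? z w) (copy? (span z w)) (fits? T x₀ y₀ _ _ _ _ _ _) (to z w)
          (from₁ z w) (from₂ z w))) ⟩
    ∑ V (λ z → ∑ V (λ w → ⟦ fits? T x₀ y₀ (ρ x y) (ρ x z) (ρ y z) (ρ x w) (ρ y w) (ρ z w) ⟧)) ∎
    where
    copy? = isCopy? T x₀ y₀ G x y

    reorder : ∀ a b c → a * (b * c) ≡ c * (b * a)
    reorder a b c = trans (*-comm a _) (trans (*-congʳ (*-comm b c)) (*-assoc c b a))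

    only : ∀ z w → ∑ (subsets n) (λ S → ⟦ copy? S ⟧ * (⟦ distinct? z w ⟧ * ⟦ span z w ≟ᵛ S ⟧)) ≡ ⟦ distinct? z w ⟧ * ⟦ copy? (span z w) ⟧
    only z w = trans (∑-cong (subsets n) (λ S → reorder ⟦ copy? S ⟧ _ _))
      (∑-δ _≟ᵛ_ (subsets-unique n) (∈-subsets (span z w)) (λ S → ⟦ distinct? z w ⟧ * ⟦ copy? S ⟧))

    ≢same : ∀ {u v} → u ≢ v → ρ u v ≢ same
    ≢same u≢v eq = u≢v (rel≡same⇒≡ G eq)

    ≢same⁻ : ∀ {u v} → ρ u v ≢ same → u ≢ v
    ≢same⁻ {u} r≢ refl = r≢ (rel-same G u)

    to : ∀ z w → Distinct z w → IsCopy T x₀ y₀ G x y (span z w) → Fits T x₀ y₀ (ρ x y) (ρ x z) (ρ y z) (ρ x w) (ρ y w) (ρ z w)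
    to z w d@(a , b , c , e , f) copy = (≢same a , ≢same b , ≢same c , ≢same e , ≢same f) ,
      copy-pull G T x₀ y₀ (quad T x₀ y₀ (ρ x y) (ρ x z) (ρ y z) (ρ x w) (ρ y w) (ρ z w)) (x ∷ y ∷ z ∷ w ∷ [])
          (injective-span d) (induced-span z w) 0F 1F copy

    from₁ : ∀ z w → Fits T x₀ y₀ (ρ x y) (ρ x z) (ρ y z) (ρ x w) (ρ y w) (ρ z w) → Distinct z w
    from₁ z w ((a , b , c , e , f) , _) = ≢same⁻ a , ≢same⁻ b , ≢same⁻ c , ≢same⁻ e , ≢same⁻ f

    from₂ : ∀ z w → Fits T x₀ y₀ (ρ x y) (ρ x z) (ρ y z) (ρ x w) (ρ y w) (ρ z w) → IsCopy T x₀ y₀ G x y (span z w)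
    from₂ z w fits@(_ , copy) = copy-push G T x₀ y₀ (quad T x₀ y₀ (ρ x y) (ρ x z) (ρ y z) (ρ x w) (ρ y w) (ρ z w))
        (x ∷ y ∷ z ∷ w ∷ []) (injective-span (from₁ z w fits)) (induced-span z w) 0F 1F copy

-- From certificates to strong regularity and the 4-vertex condition

∑-allFin-suc : ∀ {n} (f : Fin (suc n) → ℤ) → ∑ (allFin (suc n)) f ≡ f zero + ∑ (allFin n) (λ i → f (suc i))
∑-allFin-suc {n} f = +-congˡ (trans (cong (λ xs → ∑ xs f) (sym (List.map-tabulate (λ i → i) Fin.suc)))
    (∑-map Fin.suc (allFin n) f))

∣∩∣≡∑ : ∀ {n} (f g : Fin n → Bool) → ℤ.+ ∣ Vec.tabulate f ∩ Vec.tabulate g ∣ ≡ ∑ (allFin n)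
    (λ z → indicator (f z) * indicator (g z))
∣∩∣≡∑ {zero}  f g = refl
∣∩∣≡∑ {suc n} f g = trans (head (f zero) (g zero)) (trans (+-congˡ (∣∩∣≡∑ (f ∘ suc) (g ∘ suc)))
    (sym (∑-allFin-suc (λ z → indicator (f z) * indicator (g z)))))
  where
  m = ∣ Vec.tabulate (f ∘ suc) ∩ Vec.tabulate (g ∘ suc) ∣
  head : ∀ a b → ℤ.+ ∣ (a ∧ b) ∷ (Vec.tabulate (f ∘ suc) ∩ Vec.tabulate (g ∘ suc)) ∣ ≡ indicator a * indicator b + ℤ.+ m
  head true  true  = trans (pos-+ 1 m) (+-congʳ (sym (*-identityʳ 1ℤ)))
  head true  false = sym (trans (+-congʳ (zeroʳ 1ℤ)) (+-identityˡ _))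
  head false b     = sym (trans (+-congʳ (zeroˡ _)) (+-identityˡ _))

module _ {n} {G : Graph n} (cert : Certificate G) where
  open Agreement cert

  certificate⇒vertexCondition : VertexCondition 4 G
  certificate⇒vertexCondition T x₀ y₀ x₀≢y₀ x y x′ y′ x≢y x′≢y′ adj≡ = double-injective _ _ (begin
    ℤ.+ copies T x₀ y₀ G x y * (1ℤ + 1ℤ)
      ≡⟨ copies-by-pairs T x₀ y₀ x₀≢y₀ G x y x≢y ⟩
    ∑ V (λ z → ∑ V (λ w → ⟦ fits? T x₀ y₀ (ρ x y) (ρ x z) (ρ y z) (ρ x w) (ρ y w) (ρ z w) ⟧))
      -- Once `ρ x y` is held fixed, whether `z` and `w` complete a copy is a function of the five
      -- remaining relations.
      ≡⟨ agree₅′ same-rel x≢y x′≢y′ (λ a b c d e → ⟦ fits? T x₀ y₀ (ρ x y) a b c d e ⟧) ⟩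
    ∑ V (λ z → ∑ V (λ w → ⟦ fits? T x₀ y₀ (ρ x y) (ρ x′ z) (ρ y′ z) (ρ x′ w) (ρ y′ w) (ρ z w) ⟧))
      ≡⟨ cong (λ r → ∑ V (λ z → ∑ V (λ w → ⟦ fits? T x₀ y₀ r (ρ x′ z) (ρ y′ z) (ρ x′ w) (ρ y′ w) (ρ z w) ⟧))) same-rel ⟩
    ∑ V (λ z → ∑ V (λ w → ⟦ fits? T x₀ y₀ (ρ x′ y′) (ρ x′ z) (ρ y′ z) (ρ x′ w) (ρ y′ w) (ρ z w) ⟧))
      ≡⟨ copies-by-pairs T x₀ y₀ x₀≢y₀ G x′ y′ x′≢y′ ⟨
    ℤ.+ copies T x₀ y₀ G x′ y′ * (1ℤ + 1ℤ) ∎)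
    where
    V = allFin n
    ρ = rel G
    same-rel : ρ x y ≡ ρ x′ y′
    same-rel = trans (rel-≢ G x≢y) (trans (cong (λ b → if b then edge else nonedge) adj≡) (sym (rel-≢ G x′≢y′)))

  common≡ : ∀ {x y x′ y′} → rel G x y ≡ rel G x′ y′ → ∣ commonNeighbours G x y ∣ ≡ ∣ commonNeighbours G x′ y′ ∣
  common≡ {x} {y} {x′} {y′} same-rel = ℤ.+-injective (trans (as-W₂ x y)
      (trans (agree₂ same-rel adjacency adjacency) (sym (as-W₂ x′ y′))))
    where
    as-W₂ : ∀ x y → ℤ.+ ∣ commonNeighbours G x y ∣ ≡ W₂ adjacency adjacency x y
    as-W₂ x y = trans (∣∩∣≡∑ (adj G x) (adj G y))
      (∑-cong (allFin n) (λ z → cong₂ (λ b c → indicator b * indicator c) (adj≡isEdge G x z) (adj≡isEdge G y z)))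

  certificate⇒stronglyRegular : ∀ {e e′ f f′} → adj G e e′ ≡ true → f ≢ f′ → adj G f f′ ≡ false → StronglyRegular G
  certificate⇒stronglyRegular {e} {e′} {f} {f′} ee′ f≢f′ ff′ =
    ∣ neighbours G e ∣ , ∣ commonNeighbours G e e′ ∣ , ∣ commonNeighbours G f f′ ∣ , record
      { notComplete = λ complete → case-true-false (trans (sym (complete f f′ f≢f′)) ff′)
      ; notEdgeless = λ edgeless → case-true-false (trans (sym ee′) (edgeless e e′))
      -- The degree is the number of common neighbours of a vertex with itself, and all pairs
      -- `x , x` have the relation `same`.
      ; regular     = λ x → subst₂ (λ p q → ∣ p ∣ ≡ ∣ q ∣) (Subset.∩-idem (neighbours G x))
          (Subset.∩-idem (neighbours G e)) (common≡ {x} {x} {e} {e} (trans (rel-same G x) (sym (rel-same G e))))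
      ; adjacent    = λ x y xy → common≡ (trans (rel-adj xy) (sym (rel-adj ee′)))
      ; nonadjacent = λ x y x≢y xy → common≡ (trans (rel-nonadj x≢y xy) (sym (rel-nonadj f≢f′ ff′)))
      }
    where
    case-true-false : true ≢ false
    case-true-false ()
    rel-adj : ∀ {x y} → adj G x y ≡ true → rel G x y ≡ edge
    rel-adj {x} {y} xy = trans (rel-≢ G (λ { refl → case-true-false (trans (sym xy) (Graph.irrefl G x)) }))
                               (cong (λ b → if b then edge else nonedge) xy)
    rel-nonadj : ∀ {x y} → x ≢ y → adj G x y ≡ false → rel G x y ≡ nonedge
    rel-nonadj x≢y xy = trans (rel-≢ G x≢y) (cong (λ b → if b then edge else nonedge) xy)

-- The two families

mate : ∀ m → Fin (m ℕ.+ m) → Fin (m ℕ.+ m)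
mate m x = join m m (Sum.swap (splitAt m x))

mate-involutive : ∀ m (x : Fin (m ℕ.+ m)) → mate m (mate m x) ≡ x
mate-involutive m x = begin
  join m m (Sum.swap (splitAt m (join m m (Sum.swap (splitAt m x))))) ≡⟨ cong (λ y → join m m (Sum.swap y))
      (Fin.splitAt-join m m (Sum.swap (splitAt m x))) ⟩
  join m m (Sum.swap (Sum.swap (splitAt m x)))                        ≡⟨ cong (join m m) (Sum.swap-involutive (splitAt m x)) ⟩
  join m m (splitAt m x)                                              ≡⟨ Fin.join-splitAt m m x ⟩
  x                                                                   ∎

mate-≢ : ∀ m (x : Fin (m ℕ.+ m)) → mate m x ≢ x
mate-≢ m x eq = swap-≢ (splitAt m x) (trans (sym (Fin.splitAt-join m m _)) (cong (splitAt m) eq))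
  where
  swap-≢ : (y : Fin m ⊎ Fin m) → Sum.swap y ≢ y
  swap-≢ (inj₁ _) ()
  swap-≢ (inj₂ _) ()

mate-≡ : ∀ m {x y : Fin (m ℕ.+ m)} → mate m x ≡ y → mate m y ≡ x
mate-≡ m {x} refl = mate-involutive m x

matching : ∀ m → Graph (m ℕ.+ m)
matching m = record
  { adj    = λ x y → does (mate m x Fin.≟ y)
  ; sym    = λ x y → does-⇔ (mk⇔ (mate-≡ m) (mate-≡ m)) (mate m x Fin.≟ y) (mate m y Fin.≟ x)
  ; irrefl = λ x → dec-false (mate m x Fin.≟ x) (mate-≢ m x)
  }

-- The adjacency matrix serves as `s`. It is the matrix of a fixed-point-free involution, so its
-- rows have sum 1 and its square is the identity. Distinct vertices have disjoint neighbourhoods,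
-- so the last moment vanishes term by term.
matching-certificate : ∀ m → Certificate (matching m)
matching-certificate m = record
  { s         = adjacency
  ; separates = λ ()
  ; moment₁   = 1ℤ
  ; row       = λ x → trans (∑-cong V (λ z → trans (weight x z) (sym (*-identityʳ _)))) (pick x (λ _ → 1ℤ))
  ; moment₂   = I
  ; pair      = λ x y → trans (∑-cong V (λ z → *-congʳ (weight x z))) (trans (pick x (λ z → adjacency (ρ y z)))
                  (trans (weight y (mate m x)) (⟦⟧-cong (mate m y Fin.≟ mate m x) (same ≟ʳ ρ x y)
                    (λ eq → sym (trans (cong (ρ x) (mate-injective eq)) (rel-same G x)))
                    (λ eq → cong (mate m) (sym (rel≡same⇒≡ G (sym eq)))))))
  ; moment₃   = 0ℤ
  ; quadruple = λ x y x≢y → trans (∑-cong V (λ z → trans (∑-cong V (λ w →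
                  trans (*-congʳ (trans (*-congʳ (disjoint x≢y z)) (zeroˡ _))) (zeroˡ _))) (∑-0 V))) (∑-0 V)
  }
  where
  G = matching m
  V = allFin (m ℕ.+ m)
  ρ = rel G
  weight : ∀ x z → adjacency (ρ x z) ≡ ⟦ mate m x Fin.≟ z ⟧
  weight x z = cong indicator (sym (adj≡isEdge G x z))
  pick : ∀ x f → ∑ V (λ z → ⟦ mate m x Fin.≟ z ⟧ * f z) ≡ f (mate m x)
  pick x f = ∑-δ Fin._≟_ (Unique.allFin⁺ (m ℕ.+ m)) (∈-allFin (mate m x)) f
  mate-injective : ∀ {x y} → mate m y ≡ mate m x → y ≡ x
  mate-injective {x} {y} eq = trans (sym (mate-involutive m y)) (trans (cong (mate m) eq) (mate-involutive m x))
  disjoint : ∀ {x y} → x ≢ y → ∀ z → adjacency (ρ x z) * adjacency (ρ y z) ≡ 0ℤ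
  disjoint {x} {y} x≢y z = trans (cong₂ _*_ (weight x z) (weight y z)) (both (mate m x Fin.≟ z) (mate m y Fin.≟ z))
    where
    both : (p? : Dec (mate m x ≡ z)) (q? : Dec (mate m y ≡ z)) → ⟦ p? ⟧ * ⟦ q? ⟧ ≡ 0ℤ
    both (no _)    q?        = zeroˡ _
    both (yes _)   (no _)    = zeroʳ _
    both (yes refl) (yes eq) = contradiction (sym (mate-injective eq)) x≢y

-- At least two edges are taken because a single edge is a complete graph. With two or more, the
-- vertices 0 and 1 lie in the same half and are not mates.
matching-stronglyRegular : ∀ m → StronglyRegular (matching (2 ℕ.+ m))
matching-stronglyRegular m = certificate⇒stronglyRegular (matching-certificate (2 ℕ.+ m))
  {e = zero} {e′ = mate (2 ℕ.+ m) zero} {f = zero} {f′ = suc zero}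
  (dec-true (mate (2 ℕ.+ m) zero Fin.≟ mate (2 ℕ.+ m) zero) refl)
  (λ ()) (dec-false (mate (2 ℕ.+ m) zero Fin.≟ suc zero) (λ ()))

matching-vertexCondition : ∀ m → VertexCondition 4 (matching m)
matching-vertexCondition m = certificate⇒vertexCondition (matching-certificate m)

-- Graphs on the nonzero points

lookup-injective : ∀ {A : Set} {xs : List A} → Unique xs → ∀ i j → lookup xs i ≡ lookup xs j → i ≡ j
lookup-injective (x∉ ∷ u) zero    zero    eq = refl
lookup-injective (x∉ ∷ u) zero    (suc j) eq = contradiction eq (All.lookup x∉ (∈-lookup j))
lookup-injective (x∉ ∷ u) (suc i) zero    eq = contradiction (sym eq) (All.lookup x∉ (∈-lookup i))
lookup-injective (x∉ ∷ u) (suc i) (suc j) eq = cong suc (lookup-injective u i j eq)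

∑-lookup : ∀ {A : Set} (xs : List A) (f : A → ℤ) → ∑ (allFin (length xs)) (λ i → f (lookup xs i)) ≡ ∑ xs f
∑-lookup xs f = trans (sym (∑-map (lookup xs) (allFin (length xs)) f))
  (cong (λ ys → ∑ ys f) (trans (List.map-tabulate (λ i → i) (lookup xs)) (List.tabulate-lookup xs)))

0ₚ : ∀ {d} → Point d
0ₚ = 0ᵛ , 0ᵛ

points-unique : ∀ d → Unique (points d)
points-unique d = Unique.cartesianProduct⁺ (subsets-unique d) (subsets-unique d)

∈-points : ∀ {d} (x : Point d) → x ∈ points d
∈-points (a , b) = ∈-cartesianProduct⁺ (∈-subsets a) (∈-subsets b)

opaque
  -- As a vertex, 0 would be adjacent to all others, because its row of S is constantly 1.
  nonzeros : ∀ d → List (Point d)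
  nonzeros d = filter (λ x → ¬? (0ₚ ≟ₚ x)) (points d)

  nonzeros-unique : ∀ d → Unique (nonzeros d)
  nonzeros-unique d = Unique.filter⁺ (λ x → ¬? (0ₚ ≟ₚ x)) (points-unique d)

  ∈-nonzeros⁺ : ∀ {d} {x : Point d} → 0ₚ ≢ x → x ∈ nonzeros d
  ∈-nonzeros⁺ {x = x} x≢0 = ∈-filter⁺ (λ x → ¬? (0ₚ ≟ₚ x)) (∈-points x) x≢0

  ∈-nonzeros⁻ : ∀ {d} {x : Point d} → x ∈ nonzeros d → 0ₚ ≢ x
  ∈-nonzeros⁻ {d} x∈ = proj₂ (∈-filter⁻ (λ x → ¬? (0ₚ ≟ₚ x)) {xs = points d} x∈)

  ∑-nonzeros : ∀ d (f : Point d → ℤ) → ∑ (nonzeros d) f + f 0ₚ ≡ ∑ (points d) f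
  ∑-nonzeros d f = sym (∑-remove _≟ₚ_ (points-unique d) (∈-points 0ₚ) f)

order : ℕ → ℕ
order d = length (nonzeros d)

point : ∀ {d} → Fin (order d) → Point d
point {d} = lookup (nonzeros d)

point-injective : ∀ {d} (i j : Fin (order d)) → point i ≡ point j → i ≡ j
point-injective {d} = lookup-injective (nonzeros-unique d)

point-≢0 : ∀ {d} (i : Fin (order d)) → 0ₚ ≢ point i
point-≢0 i = ∈-nonzeros⁻ (∈-lookup i)

module _ {d} {x : Point d} (x≢0 : 0ₚ ≢ x) where

  vertex : Fin (order d)
  vertex = index (∈-nonzeros⁺ x≢0)

  point-vertex : point vertex ≡ x
  point-vertex = sym (Any.lookup-index (∈-nonzeros⁺ x≢0))

∑-points : ∀ {d} (f : Point d → ℤ) → ∑ (allFin (order d)) (λ i → f (point i)) + f 0ₚ ≡ ∑ (points d) f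
∑-points {d} f = trans (+-congʳ (∑-lookup (nonzeros d) f)) (∑-nonzeros d f)

length-cartesianProduct : ∀ {A B : Set} (xs : List A) (ys : List B) →
                          length (cartesianProduct xs ys) ≡ length xs ℕ.* length ys
length-cartesianProduct []       ys = refl
length-cartesianProduct (x ∷ xs) ys = trans (List.length-++ (List.map (x ,_) ys))
  (cong₂ ℕ._+_ (List.length-map (x ,_) ys) (length-cartesianProduct xs ys))

order+1 : ∀ d → suc (order d) ≡ 2 ℕ.^ d ℕ.* 2 ℕ.^ d
order+1 d = begin
  suc (length (nonzeros d))              ≡⟨ ℕ.+-comm 1 _ ⟩
  length (nonzeros d) ℕ.+ 1              ≡⟨ ℤ.+-injective (trans (pos-+ _ 1) count) ⟩
  length (points d)                      ≡⟨ length-cartesianProduct (subsets d) (subsets d) ⟩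
  length (subsets d) ℕ.* length (subsets d) ≡⟨ cong₂ ℕ._*_ (length-subsets d) (length-subsets d) ⟩
  2 ℕ.^ d ℕ.* 2 ℕ.^ d                    ∎
  where
  total : ∀ {A : Set} (xs : List A) → ∑ xs (λ _ → 1ℤ) ≡ ℤ.+ length xs
  total xs = trans (∑-const xs 1ℤ) (*-identityʳ _)
  count : ℤ.+ length (nonzeros d) + 1ℤ ≡ ℤ.+ length (points d)
  count = trans (+-congʳ (sym (total (nonzeros d))))
    (trans (∑-nonzeros d (λ _ → 1ℤ)) (total (points d)))

opaque
  graph : ∀ {d} → (Vec Bool d → Vec Bool d) → Graph (order d)
  graph {d} σ = record
    { adj    = adj′
    ; sym    = λ i j → cong₂ _∧_ (does-⇔ (mk⇔ ≢-sym ≢-sym) (¬? (i Fin.≟ j)) (¬? (j Fin.≟ i)))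
        (cong not (form-sym σ (point i) (point j)))
    ; irrefl = λ i → cong (_∧ not (form σ (point i) (point i))) (dec-false (¬? (i Fin.≟ i)) (λ i≢i → i≢i refl))
    }
    where
    adj′ : Fin (order d) → Fin (order d) → Bool
    adj′ i j = does (¬? (i Fin.≟ j)) ∧ not (form σ (point i) (point j))

  graph-adj : ∀ {d} (σ : Vec Bool d → Vec Bool d) {i j} → i ≢ j → adj (graph σ) i j ≡ not (form σ (point i) (point j))
  graph-adj σ {i} {j} i≢j = cong (_∧ not (form σ (point i) (point j))) (dec-true (¬? (i Fin.≟ j)) i≢j)

-- The value at `same` is the diagonal entry of S, which is 1 because the form of a point with
-- itself vanishes.
weight : Relation → ℤ
weight same    = 1ℤ
weight edge    = 1ℤ
weight nonedge = -1ℤ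

weight-rel : ∀ {d} (σ : Vec Bool d → Vec Bool d) i j → weight (rel (graph σ) i j) ≡ sgn (form σ (point i) (point j))
weight-rel σ i j with i Fin.≟ j
... | yes refl = trans (cong weight (rel-same (graph σ) i)) (cong sgn (sym (form-self σ (point i))))
... | no i≢j   = trans (cong weight (trans (rel-≢ (graph σ) i≢j) (cong (λ b → if b then edge else nonedge) (graph-adj σ i≢j))))
                       (signs (form σ (point i) (point j)))
  where
  signs : ∀ b → weight (if not b then edge else nonedge) ≡ sgn b
  signs true  = refl
  signs false = refl

hadamard-certificate : ∀ {d} {σ : Vec Bool d → Vec Bool d} → Permutation σ → Certificate (graph σ)
hadamard-certificate {d} {σ} perm = record
  { s         = weight
  ; separates = λ ()
  -- The full row of a nonzero point has sum 0, being orthogonal to the constant row of 0; leaving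
  -- out the column of 0 removes an entry 1.
  ; moment₁   = -1ℤ
  ; row       = λ x → trans (∑-cong V (weight-rel σ x)) (∑-S (point x) (point-≢0 x))
  ; moment₂   = λ r → n * n * I r + -1ℤ
  ; pair      = λ x y → trans (∑-cong V (λ z → cong₂ _*_ (weight-rel σ x z) (weight-rel σ y z)))
                  (trans (∑-SS (point x) (point y)) (+-congʳ (*-congˡ
                    (⟦⟧-cong (point x ≟ₚ point y) (same ≟ʳ rel (graph σ) x y)
                      (λ eq → sym (trans (cong (rel (graph σ) x) (sym (point-injective x y eq))) (rel-same (graph σ) x)))
                      (λ eq → cong point (rel≡same⇒≡ (graph σ) (sym eq)))))))
  -- The sum over all points is `n * n`. The terms with `w` zero and `z` nonzero amount to -1 and
  -- those with `z` zero to 0, both because the rows of `x` and `y` are orthogonal; this is where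
  -- `x ≢ y` enters.
  ; moment₃   = n * n + 1ℤ
  ; quadruple = λ x y x≢y → trans (∑-cong V (λ z → ∑-cong V (λ w →
                  cong₂ _*_ (cong₂ _*_ (cong₂ _*_ (weight-rel σ x z) (weight-rel σ y z))
                      (cong₂ _*_ (weight-rel σ x w) (weight-rel σ y w))) (weight-rel σ z w))))
                  (∑-S⁵-nonzero (point x) (point y) (λ eq → x≢y (point-injective x y eq)))
  }
  where
  open Hadamard perm
  V = allFin (order d)
  n = ℤ.+ (2 ℕ.^ d)

  S-zeroˡ : ∀ x → S 0ₚ x ≡ 1ℤ
  S-zeroˡ x = trans (cong sgn (form-sym σ 0ₚ x)) (S-zero x)

  ∑-S : ∀ x → 0ₚ ≢ x → ∑ V (λ z → S x (point z)) ≡ -1ℤ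
  ∑-S x x≢0 = +-cancelʳ 1ℤ _ _ (begin
    ∑ V (λ z → S x (point z)) + 1ℤ                 ≡⟨ +-congˡ (S-zero x) ⟨
    ∑ V (λ z → S x (point z)) + S x 0ₚ             ≡⟨ ∑-points (S x) ⟩
    ∑ (points d) (S x)                             ≡⟨ ∑-cong (points d) (λ z → trans (*-congˡ (S-zeroˡ z)) (*-identityʳ _)) ⟨
    ∑ (points d) (λ z → S x z * S 0ₚ z)            ≡⟨ ∑-S-S x 0ₚ ⟩
    n * n * ⟦ x ≟ₚ 0ₚ ⟧                            ≡⟨ *-congˡ (⟦⟧-false (x ≟ₚ 0ₚ) (≢-sym x≢0)) ⟩
    n * n * 0ℤ                                     ≡⟨ zeroʳ _ ⟩
    0ℤ                                             ≡⟨ -1+1 ⟨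
    -1ℤ + 1ℤ                                       ∎)

  ∑-SS : ∀ x y → ∑ V (λ z → S x (point z) * S y (point z)) ≡ n * n * ⟦ x ≟ₚ y ⟧ + -1ℤ
  ∑-SS x y = +-cancelʳ 1ℤ _ _ (begin
    ∑ V (λ z → S x (point z) * S y (point z)) + 1ℤ                ≡⟨ +-congˡ
        (trans (cong₂ _*_ (S-zero x) (S-zero y)) (*-identityʳ 1ℤ)) ⟨
    ∑ V (λ z → S x (point z) * S y (point z)) + S x 0ₚ * S y 0ₚ   ≡⟨ ∑-points (λ z → S x z * S y z) ⟩
    ∑ (points d) (λ z → S x z * S y z)                            ≡⟨ ∑-S-S x y ⟩
    n * n * ⟦ x ≟ₚ y ⟧                                            ≡⟨ +-identityʳ _ ⟨
    n * n * ⟦ x ≟ₚ y ⟧ + 0ℤ                                       ≡⟨ +-congˡ -1+1 ⟨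
    n * n * ⟦ x ≟ₚ y ⟧ + (-1ℤ + 1ℤ)                               ≡⟨ +-assoc _ _ _ ⟨
    n * n * ⟦ x ≟ₚ y ⟧ + -1ℤ + 1ℤ                                 ∎)

  ∑-S⁵-nonzero : ∀ x y → x ≢ y → ∑ V (λ z → ∑ V (λ w →
    S x (point z) * S y (point z) * (S x (point w) * S y (point w)) * S (point z) (point w))) ≡ n * n + 1ℤ
  ∑-S⁵-nonzero x y x≢y = +-cancelʳ -1ℤ _ _ (begin
    ∑ V (λ z → ∑ V (λ w → T (point z) (point w))) + -1ℤ
      ≡⟨ +-congˡ w-zero ⟨
    ∑ V (λ z → ∑ V (λ w → T (point z) (point w))) + ∑ V (λ z → T (point z) 0ₚ)
      ≡⟨ ∑-+ V _ _ ⟨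
    ∑ V (λ z → ∑ V (λ w → T (point z) (point w)) + T (point z) 0ₚ)
      ≡⟨ ∑-cong V (λ z → ∑-points (T (point z))) ⟩
    ∑ V (λ z → ∑ (points d) (T (point z)))
      ≡⟨ +-identityʳ _ ⟨
    ∑ V (λ z → ∑ (points d) (T (point z))) + 0ℤ
      ≡⟨ +-congˡ z-zero ⟨
    ∑ V (λ z → ∑ (points d) (T (point z))) + ∑ (points d) (T 0ₚ)
      ≡⟨ ∑-points (λ z → ∑ (points d) (T z)) ⟩
    ∑ (points d) (λ z → ∑ (points d) (T z))
      ≡⟨ ∑-S⁵ x y ⟩
    n * n
      ≡⟨ +-identityʳ _ ⟨
    n * n + 0ℤ
      ≡⟨ +-congˡ (trans (+-comm 1ℤ -1ℤ) -1+1) ⟨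
    n * n + (1ℤ + -1ℤ)
      ≡⟨ +-assoc _ _ _ ⟨
    n * n + 1ℤ + -1ℤ ∎)
    where
    T : Point d → Point d → ℤ
    T z w = S x z * S y z * (S x w * S y w) * S z w

    vanish : n * n * ⟦ x ≟ₚ y ⟧ ≡ 0ℤ
    vanish = trans (*-congˡ (⟦⟧-false (x ≟ₚ y) x≢y)) (zeroʳ _)

    one : S x 0ₚ * S y 0ₚ ≡ 1ℤ
    one = trans (cong₂ _*_ (S-zero x) (S-zero y)) (*-identityʳ 1ℤ)

    w-zero : ∑ V (λ z → T (point z) 0ₚ) ≡ -1ℤ
    w-zero = begin
      ∑ V (λ z → T (point z) 0ₚ)
        ≡⟨ ∑-cong V (λ z → trans (cong₂ _*_ (trans (*-congˡ one) (*-identityʳ _)) (S-zero (point z))) (*-identityʳ _)) ⟩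
      ∑ V (λ z → S x (point z) * S y (point z))
        ≡⟨ ∑-SS x y ⟩
      n * n * ⟦ x ≟ₚ y ⟧ + -1ℤ
        ≡⟨ trans (+-congʳ vanish) (+-identityˡ _) ⟩
      -1ℤ ∎

    z-zero : ∑ (points d) (T 0ₚ) ≡ 0ℤ
    z-zero = begin
      ∑ (points d) (T 0ₚ)
        ≡⟨ ∑-cong (points d) (λ w → trans (cong₂ _*_ (trans (*-congʳ one) (*-identityˡ _)) (S-zeroˡ w)) (*-identityʳ _)) ⟩
      ∑ (points d) (λ w → S x w * S y w)
        ≡⟨ trans (∑-S-S x y) vanish ⟩
      0ℤ ∎

-- The bits of f are the values of eval j w f at the vectors of weight at least w;
-- at the other vectors it is false.
eval : ∀ j w → Vec Bool (freedom j w) → Vec Bool j → Bool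
eval zero    zero    (b ∷ []) []          = b
eval zero    (suc w) []       []          = false
eval (suc j) w       f        (true ∷ c)  = eval j (pred w) (take (freedom j (pred w)) f) c
eval (suc j) w       f        (false ∷ c) = eval j w (drop (freedom j (pred w)) f) c

e : ∀ {d} → Fin d → Vec Bool d
e zero    = true ∷ 0ᵛ
e (suc i) = false ∷ e i

eval-0 : ∀ j w f → eval j (suc w) f 0ᵛ ≡ false
eval-0 zero    w []  = refl
eval-0 (suc j) w f   = eval-0 j w (drop (freedom j w) f)

eval-e : ∀ j w f i → eval j (2 ℕ.+ w) f (e i) ≡ false
eval-e (suc j) w f zero    = eval-0 j w (take (freedom j (suc w)) f)
eval-e (suc j) w f (suc i) = eval-e j w (drop (freedom j (suc w)) f) i

take-drop-ext : ∀ {A : Set} m {n} (f g : Vec A (m ℕ.+ n)) → take m f ≡ take m g → drop m f ≡ drop m g → f ≡ g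
take-drop-ext m f g eq₁ eq₂ = begin
  f                    ≡⟨ Vec.take++drop≡id m f ⟨
  take m f Vec.++ drop m f ≡⟨ cong₂ Vec._++_ eq₁ eq₂ ⟩
  take m g Vec.++ drop m g ≡⟨ Vec.take++drop≡id m g ⟩
  g                    ∎

eval-injective : ∀ j w f g → (∀ c → eval j w f c ≡ eval j w g c) → f ≡ g
eval-injective zero    zero    (b ∷ []) (b′ ∷ []) eq = cong (_∷ []) (eq [])
eval-injective zero    (suc w) []       []        eq = refl
eval-injective (suc j) w       f        g         eq = take-drop-ext (freedom j (pred w)) f g
  (eval-injective j (pred w) _ _ (λ c → eq (true ∷ c))) (eval-injective j w _ _ (λ c → eq (false ∷ c)))

-- Each coordinate is shifted by a function of the later ones only, so the map is undone from the
-- last coordinate backwards, whatever those functions are. They vanish at weights 0 and 1, which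
-- keeps 0 and the standard basis fixed.
triangular : ∀ d → Vec Bool (bits d) → Vec Bool d → Vec Bool d
triangular zero    f []      = []
triangular (suc d) f (b ∷ c) = (b xor eval d 2 (take (freedom d 2) f) c) ∷ triangular d (drop (freedom d 2) f) c

xor-cancelʳ : ∀ a b c → a xor c ≡ b xor c → a ≡ b
xor-cancelʳ a b c eq = begin
  a                 ≡⟨ Bool.xor-identityʳ a ⟨
  a xor false       ≡⟨ cong (a xor_) (Bool.xor-same c) ⟨
  a xor (c xor c)   ≡⟨ Bool.xor-assoc a c c ⟨
  (a xor c) xor c   ≡⟨ cong (_xor c) eq ⟩
  (b xor c) xor c   ≡⟨ Bool.xor-assoc b c c ⟩
  b xor (c xor c)   ≡⟨ cong (b xor_) (Bool.xor-same c) ⟩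
  b xor false       ≡⟨ Bool.xor-identityʳ b ⟩
  b                 ∎

triangular-injective : ∀ d f x y → triangular d f x ≡ triangular d f y → x ≡ y
triangular-injective zero    f []      []       eq = refl
triangular-injective (suc d) f (a ∷ x) (b ∷ y) eq
  with refl ← triangular-injective d _ x y (Vec.∷-injectiveʳ eq) =
  cong (_∷ x) (xor-cancelʳ a b _ (Vec.∷-injectiveˡ eq))

triangular-0 : ∀ d f → triangular d f 0ᵛ ≡ 0ᵛ
triangular-0 zero    f = refl
triangular-0 (suc d) f = cong₂ _∷_ (eval-0 d 1 _) (triangular-0 d _)

triangular-e : ∀ d f i → triangular d f (e i) ≡ e i
triangular-e (suc d) f zero    = cong₂ _∷_ (cong (true xor_) (eval-0 d 1 _)) (triangular-0 d _)
triangular-e (suc d) f (suc i) = cong₂ _∷_ (eval-e d 0 _ i) (triangular-e d _ i)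

triangular-∑ : ∀ d f (F : Vec Bool d → ℤ) → ∑ (subsets d) (λ x → F (triangular d f x)) ≡ ∑ (subsets d) F
triangular-∑ zero    f F = refl
triangular-∑ (suc d) f F = begin
  ∑ (subsets (suc d)) (λ x → F (triangular (suc d) f x))                    ≡⟨ ∑-subsets-suc d _ ⟩
  ∑ (subsets d) (λ c → F (not (s c) ∷ t c)) + ∑ (subsets d) (λ c → F (s c ∷ t c)) ≡⟨ ∑-+ (subsets d) _ _ ⟨
  -- For a fixed tail, the shift of the first coordinate either keeps or exchanges the two terms.
  ∑ (subsets d) (λ c → F (not (s c) ∷ t c) + F (s c ∷ t c))                 ≡⟨ ∑-cong (subsets d) (λ c → both (s c) (t c)) ⟩
  ∑ (subsets d) (λ c → F (true ∷ t c) + F (false ∷ t c))                    ≡⟨ triangular-∑ d _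
      (λ c → F (true ∷ c) + F (false ∷ c)) ⟩
  ∑ (subsets d) (λ c → F (true ∷ c) + F (false ∷ c))                        ≡⟨ ∑-+ (subsets d) _ _ ⟩
  ∑ (subsets d) (λ c → F (true ∷ c)) + ∑ (subsets d) (λ c → F (false ∷ c))  ≡⟨ ∑-subsets-suc d F ⟨
  ∑ (subsets (suc d)) F                                                     ∎
  where
  s : Vec Bool d → Bool
  s = eval d 2 (take (freedom d 2) f)
  t : Vec Bool d → Vec Bool d
  t = triangular d (drop (freedom d 2) f)
  both : ∀ b c → F (not b ∷ c) + F (b ∷ c) ≡ F (true ∷ c) + F (false ∷ c)
  both false c = refl
  both true  c = +-comm _ _

triangular-permutation : ∀ d f → Permutation (triangular d f)
triangular-permutation d f = record
  { injective = triangular-injective d f ; preserves0 = triangular-0 d f ; ∑-∘ = triangular-∑ d f }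

triangular-faithful : ∀ d f g → (∀ c → triangular d f c ≡ triangular d g c) → f ≡ g
triangular-faithful zero    [] [] eq = refl
triangular-faithful (suc d) f  g  eq = take-drop-ext (freedom d 2) f g
  (eval-injective d 2 _ _ (λ c → Vec.∷-injectiveˡ (eq (false ∷ c))))
  (triangular-faithful d _ _ (λ c → Vec.∷-injectiveʳ (eq (false ∷ c))))

-- Non-isomorphism

length-filter-¬ : ∀ {A : Set} {P : A → Set} (P? : Decidable P) xs →
                  length xs ≡ length (filter P? xs) ℕ.+ length (filter (λ x → ¬? (P? x)) xs)
length-filter-¬ P? []       = refl
length-filter-¬ P? (x ∷ xs) with P? x
... | yes _ = cong suc (length-filter-¬ P? xs)
... | no  _ = trans (cong suc (length-filter-¬ P? xs)) (sym (ℕ.+-suc _ _))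

module Selection {A : Set} {R : A → A → Set} (R? : ∀ x y → Dec (R x y)) {M : ℕ} .{{_ : NonZero M}}
  (code : ∀ {x y} → R x y → Fin M) (code-injective : ∀ {x y z} (p : R x y) (q : R x z) → code p ≡ code q → y ≡ z) where

  related-bound : ∀ x {xs} → Unique xs → length (filter (R? x) xs) ≤ M
  related-bound x {xs} u = Fin.injective⇒≤ {f = λ i → code (related i)} (λ {i} {j} eq →
    lookup-injective (Unique.filter⁺ (R? x) u) i j (code-injective (related i) (related j) eq))
    where
    related : ∀ i → R x (lookup (filter (R? x) xs) i)
    related i = proj₂ (∈-filter⁻ (R? x) {xs = xs} (∈-lookup i))

  -- Greedy choice: the head is kept and everything related to it is discarded. By `related-bound`
  -- this costs at most `M` elements for each one chosen.
  select : ∀ m {xs} → Unique xs → m ℕ.* M ≤ length xs →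
           Σ (Fin m → A) λ h → (∀ i → h i ∈ xs) × (∀ i j → i Fin.< j → ¬ R (h i) (h j))
  select zero    u le = (λ ()) , (λ ()) , λ ()
  select (suc m) {[]}     u le = contradiction (ℕ.m+n≡0⇒m≡0 M (ℕ.n≤0⇒n≡0 le)) (ℕ.≢-nonZero⁻¹ M)
  select (suc m) {x ∷ xs} u le
    with h , h∈ , apart ← select m (Unique.filter⁺ (λ y → ¬? (R? x y)) u) (ℕ.+-cancelˡ-≤ M _ _ (ℕ.≤-trans le
           (ℕ.≤-trans (ℕ.≤-reflexive (length-filter-¬ (R? x) (x ∷ xs))) (ℕ.+-monoˡ-≤ _ (related-bound x u)))))
    = h′ , h′∈ , apart′
    where
    h′ : Fin (suc m) → A
    h′ zero    = x
    h′ (suc i) = h i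
    h∈ˢ : ∀ i → h i ∈ x ∷ xs × ¬ R x (h i)
    h∈ˢ i = ∈-filter⁻ (λ y → ¬? (R? x y)) {xs = x ∷ xs} (h∈ i)
    h′∈ : ∀ i → h′ i ∈ x ∷ xs
    h′∈ zero    = here refl
    h′∈ (suc i) = proj₁ (h∈ˢ i)
    apart′ : ∀ i j → i Fin.< j → ¬ R (h′ i) (h′ j)
    apart′ zero    (suc j) _         = proj₂ (h∈ˢ j)
    apart′ (suc i) (suc j) (s≤s i<j) = apart i j i<j

-- A vector of values makes the existence of an isomorphism decidable by search, as the greedy
-- choice requires.
IsIsomorphism : ∀ {m n} → Graph m → Graph n → Vec (Fin n) m → Set
IsIsomorphism G H φ = Injective φ × (∀ u → ∃ λ i → Vec.lookup φ i ≡ u) × Induced H G φ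

isomorphism? : ∀ {m n} (G : Graph m) (H : Graph n) → Dec (∃ (IsIsomorphism G H))
isomorphism? {m} G H = anyVec? m λ φ →
        Fin.all? (λ i → Fin.all? λ j → (Vec.lookup φ i Fin.≟ Vec.lookup φ j) →-dec (i Fin.≟ j))
  ×-dec Fin.all? (λ u → Fin.any? λ i → Vec.lookup φ i Fin.≟ u)
  ×-dec Fin.all? (λ i → Fin.all? λ j → adj G i j Bool.≟ adj H (Vec.lookup φ i) (Vec.lookup φ j))

≅⇒isomorphism : ∀ {m n} (G : Graph m) (H : Graph n) → G ≅ H → ∃ (IsIsomorphism G H)
≅⇒isomorphism G H (φ , pres) = Vec.tabulate to ,
  (λ i j eq → trans (sym (strictlyInverseʳ i)) (trans (cong from (trans (sym (at i)) (trans eq (at j))))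
      (strictlyInverseʳ j))) ,
  (λ u → from u , trans (at (from u)) (strictlyInverseˡ u)) ,
  (λ i j → trans (pres i j) (sym (cong₂ (adj H) (at i) (at j))))
  where
  open Inverse φ
  at : ∀ i → Vec.lookup (Vec.tabulate to) i ≡ to i
  at = Vec.lookup∘tabulate to

≅-sym : ∀ {m n} (G : Graph m) (H : Graph n) → G ≅ H → H ≅ G
≅-sym G H (φ , pres) = ↔-sym φ , λ x y →
  sym (trans (pres (from x) (from y)) (cong₂ (adj H) (strictlyInverseˡ x) (strictlyInverseˡ y)))
  where
  open Inverse φ

module _ {m n} (G : Graph m) (H : Graph n) φ (iso : IsIsomorphism G H φ) where

  isomorphism-rel : ∀ x y → rel G x y ≡ rel H (Vec.lookup φ x) (Vec.lookup φ y)
  isomorphism-rel x y with x Fin.≟ y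
  ... | yes refl = trans (rel-same G x) (sym (rel-same H _))
  ... | no x≢y   = trans (rel-≢ G x≢y) (trans (cong (λ b → if b then edge else nonedge) (proj₂ (proj₂ iso) x y))
                     (sym (rel-≢ H (λ eq → x≢y (proj₁ iso x y eq)))))

isomorphism-form : ∀ {d} (σ τ : Vec Bool d → Vec Bool d) φ → IsIsomorphism (graph σ) (graph τ) φ →
  ∀ x y → form σ (point x) (point y) ≡ form τ (point (Vec.lookup φ x)) (point (Vec.lookup φ y))
isomorphism-form σ τ φ iso x y = sgn-injective _ _
  (trans (sym (weight-rel σ x y)) (trans (cong weight (isomorphism-rel (graph σ) (graph τ) φ iso x y)) (weight-rel τ _ _)))

-- Base points and the size of an isomorphism class

∙-e : ∀ {d} (x : Vec Bool d) i → x ∙ e i ≡ Vec.lookup x i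
∙-e (a ∷ x) zero    = trans (cong₂ _xor_ (Bool.∧-identityʳ a) (∙-zeroʳ x)) (Bool.xor-identityʳ a)
∙-e (a ∷ x) (suc i) = trans (cong (_xor (x ∙ e i)) (Bool.∧-zeroʳ a)) (∙-e x i)

∙-nondegenerate : ∀ {d} (x y : Vec Bool d) → (∀ i → x ∙ e i ≡ y ∙ e i) → x ≡ y
∙-nondegenerate x y eq = begin
  x                           ≡⟨ Vec.tabulate∘lookup x ⟨
  Vec.tabulate (Vec.lookup x) ≡⟨ Vec.tabulate-cong (λ i → trans (sym (∙-e x i)) (trans (eq i) (∙-e y i))) ⟩
  Vec.tabulate (Vec.lookup y) ≡⟨ Vec.tabulate∘lookup y ⟩
  y                           ∎

e-≢0 : ∀ {d} (i : Fin d) → 0ᵛ ≢ e i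
e-≢0 (suc i) eq = e-≢0 i (Vec.∷-injectiveʳ eq)

module Family (d′ : ℕ) where

  private
    d = suc d′

  σ : Vec Bool (bits d) → Vec Bool d → Vec Bool d
  σ = triangular d

  Γ : Vec Bool (bits d) → Graph (order d)
  Γ f = graph (σ f)

  twist-zero : ∀ τ (c : Vec Bool d) → twist τ 0ᵛ c ≡ τ c
  twist-zero τ c = cong (λ b → if b then τ c else c) (dec-true (0ᵛ ≟ᵛ 0ᵛ) refl)

  twist-nonzero : ∀ τ {b} (c : Vec Bool d) → 0ᵛ ≢ b → twist τ b c ≡ c
  twist-nonzero τ {b} c b≢0 = cong (λ b → if b then τ c else c) (dec-false (0ᵛ ≟ᵛ b) b≢0)

  twist-e : ∀ f c i → twist (σ f) c (e i) ≡ e i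
  twist-e f c i with does (0ᵛ ≟ᵛ c)
  ... | true  = triangular-e d f i
  ... | false = refl

  -- The form with `(0ᵛ , e i)` reads coordinate `i` of the first component of a point, and the form
  -- with `(e i , e zero)` reads coordinate `i` of the second, up to a bit already known. The
  -- nonzero component `e zero` switches the twist off; with `(e i , 0ᵛ)` one would read a
  -- coordinate of `σ f c` instead of `c`.
  basePoint : Fin d ⊎ Fin d → Point d
  basePoint (inj₁ i) = 0ᵛ , e i
  basePoint (inj₂ i) = e i , e zero

  basePoint-≢0 : ∀ k → 0ₚ ≢ basePoint k
  basePoint-≢0 (inj₁ i) eq = e-≢0 i (cong proj₂ eq)
  basePoint-≢0 (inj₂ i) eq = e-≢0 {d} zero (cong proj₂ eq)

  -- The forms against the base points do not depend on f, because σ f fixes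
  -- the standard basis.
  signature : Point d → Fin d ⊎ Fin d → Bool
  signature (a , c) (inj₁ i) = a ∙ e i
  signature (a , c) (inj₂ i) = (a ∙ e zero) xor (c ∙ e i)

  form-basePoint : ∀ f x k → form (σ f) x (basePoint k) ≡ signature x k
  form-basePoint f (a , c) (inj₁ i) = trans (cong₂ _xor_ (cong (a ∙_) (twist-e f c i)) (∙-zeroˡ (twist (σ f) (e i) c)))
      (Bool.xor-identityʳ _)
  form-basePoint f (a , c) (inj₂ i) = cong₂ _xor_ (cong (a ∙_) (twist-e f c zero))
    (trans (cong (e i ∙_) (twist-nonzero (σ f) c (e-≢0 {d} zero))) (∙-comm (e i) c))

  signature-injective : ∀ x y → (∀ k → signature x k ≡ signature y k) → x ≡ y
  signature-injective (a , c) (a′ , c′) eq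
    with refl ← ∙-nondegenerate a a′ (λ i → eq (inj₁ i)) =
    cong (a ,_) (∙-nondegenerate c c′ (λ i → xor-cancelˡ (a ∙ e zero) (eq (inj₂ i))))
    where
    xor-cancelˡ : ∀ u {v w} → u xor v ≡ u xor w → v ≡ w
    xor-cancelˡ u {v} {w} eq = xor-cancelʳ v w u (trans (Bool.xor-comm v u) (trans eq (Bool.xor-comm u w)))

  base : Fin (d ℕ.+ d) → Fin (order d)
  base k = vertex (basePoint-≢0 (splitAt d k))

  form-base : ∀ f x k → form (σ f) (point x) (point (base k)) ≡ signature (point x) (splitAt d k)
  form-base f x k = trans (cong (form (σ f) (point x)) (point-vertex (basePoint-≢0 (splitAt d k))))
      (form-basePoint f (point x) (splitAt d k))

  signature-vertex : ∀ x y → (∀ k → signature (point x) (splitAt d k) ≡ signature (point y) (splitAt d k)) → x ≡ y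
  signature-vertex x y eq = point-injective x y (signature-injective (point x) (point y) (λ k →
    subst (λ k → signature (point x) k ≡ signature (point y) k) (Fin.splitAt-join d d k) (eq (Fin.join d d k))))

  -- The first argument is the target: a whole class is mapped into one graph, and there the images
  -- of the base points can be compared.
  Isomorphic : Vec Bool (bits d) → Vec Bool (bits d) → Set
  Isomorphic f g = ∃ (IsIsomorphism (Γ g) (Γ f))

  -- Let `φ` send `y` to the point `φ′ x`. Both maps preserve the form, so `y` in the source of `φ`
  -- and `x` in the source of `φ′` have equal forms with the base points. These values involve
  -- neither `g` nor `g′` and they identify a point, so `x ≡ y`.
  isomorphism-determined : ∀ {f g g′} φ φ′ → IsIsomorphism (Γ g) (Γ f) φ → IsIsomorphism (Γ g′) (Γ f) φ′ →
    (∀ k → Vec.lookup φ (base k) ≡ Vec.lookup φ′ (base k)) → ∀ x → Vec.lookup φ x ≡ Vec.lookup φ′ x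
  isomorphism-determined {f} {g} {g′} φ φ′ iso iso′ eq x
    with y , φy≡φ′x ← proj₁ (proj₂ iso) (Vec.lookup φ′ x) =
    trans (cong (Vec.lookup φ) (signature-vertex x y same-signature)) φy≡φ′x
    where
    same-signature : ∀ k → signature (point x) (splitAt d k) ≡ signature (point y) (splitAt d k)
    same-signature k = begin
      signature (point x) (splitAt d k)
        ≡⟨ form-base g′ x k ⟨
      form (σ g′) (point x) (point (base k))
        ≡⟨ isomorphism-form (σ g′) (σ f) φ′ iso′ x (base k) ⟩
      form (σ f) (point (Vec.lookup φ′ x)) (point (Vec.lookup φ′ (base k)))
        ≡⟨ cong₂ (λ u w → form (σ f) (point u) (point w)) φy≡φ′x (eq k) ⟨
      form (σ f) (point (Vec.lookup φ y)) (point (Vec.lookup φ (base k)))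
        ≡⟨ isomorphism-form (σ g) (σ f) φ iso y (base k) ⟨
      form (σ g) (point y) (point (base k))
        ≡⟨ form-base g y k ⟩
      signature (point y) (splitAt d k) ∎

  form-recovers : ∀ f a u → form (σ f) (a , 0ᵛ) (0ᵛ , u) ≡ σ f u ∙ a
  form-recovers f a u = trans (cong₂ _xor_ (cong (a ∙_) (twist-zero (σ f) u)) (∙-zeroˡ (twist (σ f) u 0ᵛ)))
                              (trans (Bool.xor-identityʳ _) (∙-comm a _))

  -- The twist is visible between `(e i , 0ᵛ)` and `(0ᵛ , u)`, where the form is coordinate `i` of
  -- the image of `u`. The vector `u = 0ᵛ` gives no vertex and is settled by the fixed point.
  forms-determine : ∀ {f g} → (∀ x y → form (σ f) (point x) (point y) ≡ form (σ g) (point x) (point y)) → f ≡ g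
  forms-determine {f} {g} eq = triangular-faithful d f g σ≡
    where
    σ≡ : ∀ u → σ f u ≡ σ g u
    σ≡ u with 0ᵛ ≟ᵛ u
    ... | yes refl = trans (triangular-0 d f) (sym (triangular-0 d g))
    ... | no u≢0   = ∙-nondegenerate _ _ (λ i → begin
      σ f u ∙ e i                                 ≡⟨ form-recovers f (e i) u ⟨
      form (σ f) (e i , 0ᵛ) (0ᵛ , u)              ≡⟨ cong₂ (form (σ f)) (point-vertex (a≢0 i)) (point-vertex b≢0) ⟨
      form (σ f) (point (vertex (a≢0 i))) (point (vertex b≢0)) ≡⟨ eq _ _ ⟩
      form (σ g) (point (vertex (a≢0 i))) (point (vertex b≢0)) ≡⟨ cong₂ (form (σ g)) (point-vertex (a≢0 i)) (point-vertex b≢0) ⟩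
      form (σ g) (e i , 0ᵛ) (0ᵛ , u)              ≡⟨ form-recovers g (e i) u ⟩
      σ g u ∙ e i                                 ∎)
      where
      a≢0 : ∀ i → 0ₚ ≢ (e i , 0ᵛ)
      a≢0 i eq = e-≢0 i (cong proj₁ eq)
      b≢0 : 0ₚ ≢ (0ᵛ , u)
      b≢0 eq = u≢0 (cong proj₂ eq)

  code : ∀ {f g} → Isomorphic f g → Fin (order d ^ (d ℕ.+ d))
  code (φ , _) = funToFin (λ k → Vec.lookup φ (base k))

  code-injective : ∀ {f g g′} (p : Isomorphic f g) (q : Isomorphic f g′) → code p ≡ code q → g ≡ g′
  code-injective {f} {g} {g′} (φ , iso) (φ′ , iso′) eq = forms-determine (λ x y → begin
    form (σ g) (point x) (point y)
      ≡⟨ isomorphism-form (σ g) (σ f) φ iso x y ⟩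
    form (σ f) (point (Vec.lookup φ x)) (point (Vec.lookup φ y))
      ≡⟨ cong₂ (λ u w → form (σ f) (point u) (point w)) (φ≗φ′ x) (φ≗φ′ y) ⟩
    form (σ f) (point (Vec.lookup φ′ x)) (point (Vec.lookup φ′ y))
      ≡⟨ isomorphism-form (σ g′) (σ f) φ′ iso′ x y ⟨
    form (σ g′) (point x) (point y) ∎)
    where
    φ≗φ′ : ∀ x → Vec.lookup φ x ≡ Vec.lookup φ′ x
    φ≗φ′ = isomorphism-determined φ φ′ iso iso′ (λ k → trans (sym (Fin.finToFun-funToFin (λ k → Vec.lookup φ (base k)) k))
      (trans (cong (λ c → finToFun c k) eq) (Fin.finToFun-funToFin (λ k → Vec.lookup φ′ (base k)) k)))

  order-nonZero : NonZero (order d)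
  order-nonZero = Fin.nonZeroIndex (base zero)

  distinct-family : ∀ m → m ℕ.* order d ^ (d ℕ.+ d) ≤ 2 ^ bits d →
    Σ (Fin m → Vec Bool (bits d)) λ h → ∀ i j → i ≢ j → ¬ (Γ (h i) ≅ Γ (h j))
  distinct-family m le
    with h , _ , apart ← Selection.select (λ f g → isomorphism? (Γ g) (Γ f))
           {{ℕ.m^n≢0 (order d) (d ℕ.+ d) {{order-nonZero}}}} code code-injective m (subsets-unique (bits d))
           (ℕ.≤-trans le (ℕ.≤-reflexive (sym (length-subsets (bits d))))) = h , noniso
    where
    noniso : ∀ i j → i ≢ j → ¬ (Γ (h i) ≅ Γ (h j))
    noniso i j i≢j iso with Fin.<-cmp i j
    -- For `i` below `j`, what is excluded is a map from the later graph to the earlier one, hence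
    -- the inversion.
    ... | tri< i<j _ _ = apart i j i<j (≅⇒isomorphism (Γ (h j)) (Γ (h i)) (≅-sym (Γ (h i)) (Γ (h j)) iso))
    ... | tri≈ _ i≡j _ = i≢j i≡j
    ... | tri> _ _ j<i = apart j i j<i (≅⇒isomorphism (Γ (h i)) (Γ (h j)) iso)

graph-vertexCondition : ∀ d f → VertexCondition 4 (graph (triangular d f))
graph-vertexCondition d f = certificate⇒vertexCondition (hadamard-certificate (triangular-permutation d f))

-- Witnesses that do not depend on `f`: `(0ᵛ , e zero)` and `(0ᵛ , e (suc zero))` have form 0 and
-- are adjacent, which takes two basis vectors. `(e zero , 0ᵛ)` and `(0ᵛ , e zero)` have form 1
-- because the basis is fixed.
graph-stronglyRegular : ∀ d f → StronglyRegular (graph (triangular (2 ℕ.+ d) f))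
graph-stronglyRegular d f = certificate⇒stronglyRegular (hadamard-certificate (triangular-permutation (2 ℕ.+ d) f))
  (trans (graph-adj (σ f) {vertex b≢0} {vertex c≢0} (vertex-≢ b≢0 c≢0 λ ()))
    (cong not (trans (cong₂ (form (σ f)) (point-vertex b≢0) (point-vertex c≢0))
                     (cong₂ _xor_ (∙-zeroˡ (twist (σ f) (e zero) (e (suc zero))))
                         (∙-zeroˡ (twist (σ f) (e (suc zero)) (e zero)))))))
  (vertex-≢ a≢0 b≢0 λ ())
  (trans (graph-adj (σ f) {vertex a≢0} {vertex b≢0} (vertex-≢ a≢0 b≢0 λ ()))
    (cong not (trans (cong₂ (form (σ f)) (point-vertex a≢0) (point-vertex b≢0))
      (trans (form-recovers f (e zero) (e zero)) (trans (cong (_∙ e zero) (triangular-e (2 ℕ.+ d) f zero))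
          (∙-e (e {2 ℕ.+ d} zero) zero))))))
  where
  open Family (suc d)
  a≢0 : 0ₚ ≢ (e {2 ℕ.+ d} zero , 0ᵛ)
  a≢0 eq = e-≢0 {2 ℕ.+ d} zero (cong proj₁ eq)
  b≢0 : 0ₚ ≢ (0ᵛ , e {2 ℕ.+ d} zero)
  b≢0 eq = e-≢0 {2 ℕ.+ d} zero (cong proj₂ eq)
  c≢0 : 0ₚ ≢ (0ᵛ , e {2 ℕ.+ d} (suc zero))
  c≢0 eq = e-≢0 {2 ℕ.+ d} (suc zero) (cong proj₂ eq)
  vertex-≢ : ∀ {x y : Point (2 ℕ.+ d)} (x≢0 : 0ₚ ≢ x) (y≢0 : 0ₚ ≢ y) → x ≢ y → vertex x≢0 ≢ vertex y≢0
  vertex-≢ x≢0 y≢0 x≢y eq = x≢y (trans (sym (point-vertex x≢0)) (trans (cong point eq) (point-vertex y≢0)))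

-- Assembling families of the required size

Good : ℕ → Σ ℕ Graph → Set
Good v Γ = proj₁ Γ ≤ v × StronglyRegular (proj₂ Γ) × VertexCondition 4 (proj₂ Γ)

Family-of : ℕ → ℕ → Set
Family-of v k = Σ (Fin k → Σ ℕ Graph) λ Γ →
  (∀ i → Good v (Γ i)) × (∀ i j → i ≢ j → ¬ (proj₂ (Γ i) ≅ proj₂ (Γ j)))

-- Stated for a variable graph, since comparing the VertexCondition of concrete
-- graphs makes the type checker unfold the lists of copies.
good : ∀ {v n} (G : Graph n) → n ≤ v → StronglyRegular G → VertexCondition 4 G → Good v (n , G)
good G n≤v sr vc = n≤v , sr , vc

matching-family : ∀ k v → k ℕ.+ k ℕ.+ 2 ≤ v → Family-of v k
matching-family k v le = (λ i → _ , matching (2 ℕ.+ toℕ i)) ,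
  (λ i → good (matching (2 ℕ.+ toℕ i)) (bound i) (matching-stronglyRegular (toℕ i))
      (matching-vertexCondition (2 ℕ.+ toℕ i))) , noniso
  where
  bound : ∀ i → (2 ℕ.+ toℕ i) ℕ.+ (2 ℕ.+ toℕ i) ≤ v
  bound i = ℕ.≤-trans (ℕ.+-mono-≤ (s≤s (Fin.toℕ<n i)) (s≤s (Fin.toℕ<n i)))
    (ℕ.≤-trans (ℕ.≤-reflexive (1+n+1+n≡n+n+2 k)) le)
  noniso : ∀ i j → i ≢ j → ¬ (matching (2 ℕ.+ toℕ i) ≅ matching (2 ℕ.+ toℕ j))
  noniso i j i≢j (φ , _) = i≢j (Fin.toℕ-injective (ℕ.+-cancelˡ-≡ 2 (toℕ i) (toℕ j)
    (half (2 ℕ.+ toℕ i) (2 ℕ.+ toℕ j) (↔⇒≡ φ))))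
    where
    half : ∀ a b → a ℕ.+ a ≡ b ℕ.+ b → a ≡ b
    half a b eq = ℕ.*-cancelʳ-≡ a b 2 (trans (n*2≡n+n a) (trans eq (sym (n*2≡n+n b))))

graph-family : ∀ d′ k v → let d = 2 ℕ.+ d′ in
  order d ≤ v → k ℕ.* order d ^ (d ℕ.+ d) ≤ 2 ^ bits d → Family-of v k
graph-family d′ k v order≤v enough = from (Family.distinct-family (suc d′) k enough)
  where
  d = 2 ℕ.+ d′
  from : (Σ (Fin k → Vec Bool (bits d)) λ h → ∀ i j → i ≢ j → ¬ (Family.Γ (suc d′) (h i) ≅ Family.Γ (suc d′) (h j))) →
      Family-of v k
  from (h , apart) =
    (λ i → order d , graph (triangular d (h i))) ,
    (λ i → good (graph (triangular d (h i))) order≤v (graph-stronglyRegular d′ (h i)) (graph-vertexCondition d (h i))) ,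
    apart

large-family : ∀ r v → 8 ≤ r → r ^ 6 ≤ v → Family-of v (r !)
large-family r v 8≤r r⁶≤v = by-log (log₂ r (ℕ.≤-trans (s≤s z≤n) 8≤r))
  where
  by-log : (∃ λ l → 2 ^ l ≤ r × r < 2 ^ suc l) → Family-of v (r !)
  by-log (l , lo , hi) = by-dimension (exponent-≥3 l (ℕ.≤-<-trans 8≤r hi))
    where
    by-dimension : (∃ λ m → l ≡ 3 ℕ.+ m) → Family-of v (r !)
    -- The first argument is `d` less 2 for `d = (3 + m) * 3`, in the shape that makes adding 2
    -- reduce to `d`. The order bound is the chain from `2 ^ (2 d) - 1` through `(2 ^ l) ^ 6` and
    -- `r ^ 6` to `v`.
    by-dimension (m , l≡3+m) = graph-family (1 ℕ.+ (2 ℕ.+ m) ℕ.* 3) (r !) v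
      (ℕ.≤-trans (ℕ.n≤1+n _) (ℕ.≤-trans (ℕ.≤-reflexive (trans (order+1 d) (cong₂ ℕ._*_ (cube (3 ℕ.+ m)) (cube (3 ℕ.+ m)))))
        (ℕ.≤-trans (power₆ (subst (λ l → 2 ^ l ≤ r) l≡3+m lo)) r⁶≤v)))
      (family-size m (ℕ.<⇒≤ (subst (λ l → r < 2 ^ suc l) l≡3+m hi)) (ℕ.≤-trans (ℕ.n≤1+n _) (ℕ.≤-reflexive (order+1 d))))
      where
      d = (3 ℕ.+ m) ℕ.* 3

theorem1p1 : ∀ (v : ℕ) → 4 ≤ v →
    Σ (Fin (⌊⁶√ v ⌋ !) → Σ ℕ Graph) λ Γ →
    (∀ i → proj₁ (Γ i) ≤ v × StronglyRegular (proj₂ (Γ i)) × VertexCondition 4 (proj₂ (Γ i)))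
    × (∀ i j → i ≢ j → ¬ (proj₂ (Γ i) ≅ proj₂ (Γ j)))
theorem1p1 v 4≤v = by-size (⌊⁶√ v ⌋ ℕ.≤? 7)
  where
  by-size : Dec (⌊⁶√ v ⌋ ≤ 7) → Family-of v (⌊⁶√ v ⌋ !)
  by-size (yes r≤7) = matching-family (⌊⁶√ v ⌋ !) v (small-family ⌊⁶√ v ⌋ v r≤7 4≤v (⌊⁶√⌋-^≤ v))
  by-size (no r≰7)  = large-family ⌊⁶√ v ⌋ v (ℕ.≰⇒> r≰7) (⌊⁶√⌋-^≤ v)
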